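{- Let $r \ge 2$ be a fixed integer. For any two positive integers $k$ and $t$ there exists a constant $c_{r,k,t}$, depending only on $r,k,t$, such that for every positive integer $n$, $$\mathrm{ex}_r(n, \Theta_{k,t}^{B}) \le c_{r,k,t}\, n^{1+\frac{1}{k}}.$$
   Context: All graphs and hypergraphs are finite and simple (no repeated edges). An $r$-uniform hypergraph is one in which every hyperedge has exactly $r$ vertices. The theta graph $\Theta_{k,t}$ is the simple ($2$-uniform) graph formed by $t$ internally vertex-disjoint paths of length $k$ (i.e. with $k$ edges) between a fixed pair of distinct vertices. For a graph $F$, a hypergraph $H$ is called a Berge-$F$ if $V(F)\subseteq V(H)$ (after identifying $F$ with an isomorphic copy) and there is a bijection $\phi:E(F)\to E(H)$ such that $e\subseteq \phi(e)$ for all $e\in E(F)$. For fixed uniformity $r$, $F^{B}=F^{B,r}$ denotes the family of all $r$-uniform hypergraphs that are a Berge-$F$; in particular $\Theta_{k,t}^{B}$ is the family of all $r$-uniform Berge-$\Theta_{k,t}$ hypergraphs. For a family $\mathcal{F}$ of $r$-uniform hypergraphs, $\mathrm{ex}_r(n,\mathcal{F})$ denotes the maximum number of hyperedges in an $n$-vertex $r$-uniform hypergraph that contains no member of $\mathcal{F}$ as a subhypergraph. -}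

module Defs where

import Data.Bool.Properties as Bool
open import Data.Fin.Base using (Fin; zero; suc; toℕ; inject₁; combine)
open import Data.Fin.Properties using (_≟_; any?; suc-injective; combine-injectiveʳ; toℕ-inject₁)
open import Data.Fin.Relation.Unary.Top using (View; view; ‵fromℕ; ‵inject₁; view-inject₁)
open import Data.Fin.Subset using (Subset; _∪_; _⊆_; ⁅_⁆; ∣_∣)
open import Data.Fin.Subset.Properties using (_∈?_; ∪-identityˡ; ∪-identityʳ; ∣⁅x⁆∣≡1)
open import Data.List.Base using (List; length; lookup; allFin; cartesianProductWith; deduplicate)
open import Data.List.Membership.Propositional using (_∈_)
open import Data.List.Relation.Unary.All using (All)
open import Data.List.Relation.Unary.All.Properties using (cartesianProductWith⁺; deduplicate⁺)
open import Data.List.Relation.Unary.Unique.Propositional using (Unique)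
import Data.List.Relation.Unary.Unique.DecPropositional.Properties as DecUnique
open import Data.Nat.Base using (ℕ; suc; pred; _+_; _*_; _≤_; NonZero)
open import Data.Nat.Properties using (1+n≢n)
open import Data.Product.Base using (Σ-syntax; ∃-syntax; _×_; _,_)
open import Data.Vec.Base using (tabulate)
open import Data.Vec.Properties using (≡-dec)
open import Function.Base using (_∘_)
open import Function.Bundles using (_↣_; _⤖_; Injection; Bijection)
open import Relation.Binary.Definitions using (DecidableEquality)
open import Relation.Binary.PropositionalEquality
  using (_≡_; _≢_; refl; sym; trans; cong; setoid)
open import Relation.Nullary using (¬_; does; contradiction)
open import Relation.Nullary.Decidable using (_×-dec_)

infix 4 _≟ˢ_ _⊑_

_≟ˢ_ : ∀ {n} → DecidableEquality (Subset n)
_≟ˢ_ = ≡-dec Bool._≟_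

image : ∀ {m n} → (Fin m → Fin n) → Subset m → Subset n
image f p = tabulate λ j → does (any? λ i → (i ∈? p) ×-dec (f i ≟ j))

-- The edge set is a duplicate-free list; nothing below depends on its order.

record Hypergraph (r n : ℕ) : Set where
  field
    edges   : List (Subset n)
    simple  : Unique edges
    uniform : All (λ e → ∣ e ∣ ≡ r) edges

  size : ℕ
  size = length edges

  Edge : Set
  Edge = Fin size

  ends : Edge → Subset n
  ends = lookup edges

open Hypergraph public using (edges; size; Edge; ends)

Graph : ℕ → Set
Graph = Hypergraph 2

Family : ℕ → Set₁
Family r = ∀ {m} → Hypergraph r m → Set

-- G is a subhypergraph of H up to relabelling: the vertices of G are
-- identified with vertices of H along an injection.

_⊑_ : ∀ {r m n} → Hypergraph r m → Hypergraph r n → Set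
_⊑_ {m = m} {n} G H =
  Σ[ f ∈ Fin m ↣ Fin n ]
    All (λ e → image (Injection.to f) e ∈ edges H) (edges G)

_IsFree-of_ : ∀ {r n} → Hypergraph r n → Family r → Set
_IsFree-of_ {r} H 𝓕 = ∀ {m} (G : Hypergraph r m) → 𝓕 G → ¬ (G ⊑ H)

-- IsEx r n 𝓕 x : the maximum ex_r(n, 𝓕) is x.

IsEx : (r n : ℕ) → Family r → ℕ → Set
IsEx r n 𝓕 x =
  (∃[ H ] (H IsFree-of 𝓕 × size {r} {n} H ≡ x)) ×
  (∀ (H : Hypergraph r n) → H IsFree-of 𝓕 → size H ≤ x)

Berge : ∀ {v} → Graph v → (r : ℕ) → Family r
Berge {v} F r {m} H =
  Σ[ ι ∈ Fin v ↣ Fin m ] Σ[ φ ∈ Edge F ⤖ Edge H ]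
    (∀ e → image (Injection.to ι) (ends F e) ⊆ ends H (Bijection.to φ e))

∣⁅x⁆∪⁅y⁆∣≡2 : ∀ {n} {x y : Fin n} → x ≢ y → ∣ ⁅ x ⁆ ∪ ⁅ y ⁆ ∣ ≡ 2
∣⁅x⁆∪⁅y⁆∣≡2 {x = zero}  {zero}  x≢y = contradiction refl x≢y
∣⁅x⁆∪⁅y⁆∣≡2 {x = zero}  {suc y} _   =
  cong suc (trans (cong ∣_∣ (∪-identityˡ ⁅ y ⁆)) (∣⁅x⁆∣≡1 y))
∣⁅x⁆∪⁅y⁆∣≡2 {x = suc x} {zero}  _   =
  cong suc (trans (cong ∣_∣ (∪-identityʳ ⁅ x ⁆)) (∣⁅x⁆∣≡1 x))
∣⁅x⁆∪⁅y⁆∣≡2 {x = suc x} {suc y} x≢y = ∣⁅x⁆∪⁅y⁆∣≡2 (x≢y ∘ cong suc)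

-- Vertices of Θ (1 + l) t: the two common ends of the paths, followed by
-- l internal vertices for each of the t paths.

module Theta (l t : ℕ) where

  Vertex : Set
  Vertex = Fin (2 + t * l)

  source sink : Vertex
  source = zero
  sink   = suc zero

  internal : Fin t → Fin l → Vertex
  internal i j = suc (suc (combine i j))

  afterSource : Fin t → {p : Fin (suc l)} → View p → Vertex
  afterSource i ‵fromℕ       = sink
  afterSource i (‵inject₁ j) = internal i j

  -- path i p is the p-th vertex of the i-th path, 0 ≤ p ≤ 1 + l.
  path : Fin t → Fin (2 + l) → Vertex
  path i zero    = source
  path i (suc p) = afterSource i (view p)

  edge : Fin t → Fin (suc l) → Subset (2 + t * l)
  edge i j = ⁅ path i (inject₁ j) ⁆ ∪ ⁅ path i (suc j) ⁆

  -- For l = 0 all t paths are the same single edge, so repetitions have to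
  -- be removed; for l ≥ 1 there are none.
  edgeList : List (Subset (2 + t * l))
  edgeList = deduplicate _≟ˢ_ (cartesianProductWith edge (allFin t) (allFin (suc l)))

  path-step : ∀ i j → path i (inject₁ j) ≢ path i (suc j)
  path-step i zero    = source≢ (view zero)
    where
    source≢ : ∀ {p} (w : View p) → source ≢ afterSource i w
    source≢ ‵fromℕ       ()
    source≢ (‵inject₁ _) ()
  path-step i (suc j) rewrite view-inject₁ j = internal≢ (view (suc j)) refl
    where
    internal≢ : ∀ {p} (w : View p) → p ≡ suc j → internal i j ≢ afterSource i w
    internal≢ ‵fromℕ       _  ()
    internal≢ (‵inject₁ q) p≡ eq
      with refl ← combine-injectiveʳ i j i q (suc-injective (suc-injective eq)) =
      1+n≢n (trans (sym (cong toℕ p≡)) (toℕ-inject₁ j))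

  edge-size : ∀ i j → ∣ edge i j ∣ ≡ 2
  edge-size i j = ∣⁅x⁆∪⁅y⁆∣≡2 (path-step i j)

Θ : (k t : ℕ) .{{_ : NonZero k}} → Graph (2 + t * pred k)
Θ (suc l) t = record
  { edges   = edgeList
  ; simple  = DecUnique.deduplicate-! _≟ˢ_ _
  ; uniform = deduplicate⁺ _≟ˢ_
      (cartesianProductWith⁺ (setoid _) (setoid _) edge (allFin t) (allFin (suc l))
        λ {i} {j} _ _ → edge-size i j)
  }
  where open Theta l t

module Submission where

-- Let k = 1 + l and s = t l.  If two vertices a, b are linked, meaning that
-- every set of at most s vertices is avoided by some a-b path of length k,
-- then t internally disjoint such paths are chosen greedily.
--
-- From hypergraph to graph.  Repeatedly pick a pair of vertices lying in few
-- remaining hyperedges and delete these.  If this gets stuck, all pairs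
-- inside the remaining hyperedges have large codegree; then two vertices of a
-- hyperedge are linked by paths of such pairs, and a Berge theta graph arises
-- by choosing distinct hyperedges for its edges.  Otherwise a positive
-- proportion of the hyperedges can be labelled by distinct pairs, and any
-- theta graph among these pairs is a Berge theta graph.
--
-- Graph bound.  Pass to a subgraph with D out-neighbours for every vertex and
-- count walks of length at most k.  Call a pair (a, z) rich if no vertex in
-- any fixed interior position lies on more than a 1/Q fraction of the clean
-- a-z walks, where a walk is clean if it is a path and no proper subwalk has
-- rich ends.
--  * A pair that is not rich is joined by boundedly many clean walks: a
--    positive fraction passes through one vertex, where the walk is split.
--  * Only O(D^(i-1)) clean walks of length i from a have rich ends.  Look at
--    the bipartite graph of their last steps w → z.  If a subgraph has large
--    minimum degree, climb in it away from a and return along a clean walk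
--    to find a linked pair.  Otherwise peel off vertices of small degree: the
--    few edges at some w carry few walks, and the few edges at some z carry
--    at most half of the walks to z, because (a, z) is rich.
-- Hence all but O(D^l) of the D^k walks from a vertex are clean with ends that
-- are not rich, so D^k = O(n).

open import Defs
open import Data.Bool.Base using (Bool; true; false)
open import Data.Empty using (⊥)
open import Data.Fin.Base using (Fin; zero; suc; toℕ; fromℕ<; cast; inject₁; combine; remQuot)
import Data.Fin.Properties as Fin
open import Data.Fin.Relation.Unary.Top using (View; view; ‵fromℕ; ‵inject₁)
open import Data.Fin.Subset using (Subset; inside; outside; ∣_∣; ⁅_⁆; _∪_)
  renaming (_∈_ to _∈ˢ_; _⊆_ to _⊆ˢ_)
open import Data.Fin.Subset.Properties using (_∈?_; ⊆-antisym; x∈p∪q⁻; x∈⁅y⁆⇒x≡y; ∪-comm)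
open import Data.List.Base
  using (List; []; _∷_; _++_; map; filter; length; lookup; tabulate; take; upTo; applyUpTo; allFin;
         cartesianProduct; cartesianProductWith)
open import Data.List.Properties
  using (filter-notAll; length-map; length-++; length-take; length-upTo; length-applyUpTo;
         length-tabulate; lookup-tabulate)
open import Data.List.Membership.Propositional using (_∈_; _∉_; find; lose)
open import Data.List.Membership.Propositional.Properties
open import Data.List.Relation.Binary.Subset.Propositional using (_⊆_)
open import Data.List.Relation.Unary.All as All using (All; []; _∷_)
import Data.List.Relation.Unary.All.Properties as All
open import Data.List.Relation.Unary.AllPairs using ([]; _∷_)
open import Data.List.Relation.Unary.Any as Any using (Any; here; there)
open import Data.List.Relation.Unary.Unique.Propositional using (Unique)
import Data.List.Relation.Unary.Unique.Propositional.Properties as Unique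
open import Data.Nat.Base
open import Data.Nat.DivMod using (_/_; _%_; m≡m%n+[m/n]*n; m%n<n)
open import Data.Nat.Induction using (<-rec; <-wellFounded)
open import Data.Nat.ListAction using (sum)
open import Data.Nat.Properties hiding (_≟_)
open import Data.Nat.Tactic.RingSolver using (solve-∀)
open import Data.Product.Base using (∃-syntax; ∃₂; _×_; _,_; proj₁; proj₂)
open import Data.Sum.Base using (_⊎_; inj₁; inj₂; swap)
open import Data.Unit.Base using (⊤; tt)
open import Data.Vec.Base as Vec using (Vec; []; _∷_)
import Data.Vec.Properties as Vec
open import Function.Base using (_∘_; const; id)
open import Function.Bundles using (mk↣; mk⤖)
open import Function.Definitions using (Injective)
open import Induction.WellFounded using (Acc; acc)
open import Relation.Binary.Definitions using (DecidableEquality; Tri; tri<; tri≈; tri>)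
open import Relation.Binary.PropositionalEquality
open import Relation.Nullary using (¬_; Dec; yes; no; does; contradiction; ¬?)
open import Relation.Nullary.Decidable using (_×-dec_; _⊎-dec_; dec-true)
open import Relation.Unary using (Decidable)
open import Relation.Unary.Properties using (∁?)

-- Sums over finite lists and comparison of duplicate-free lists.

∑ : {A : Set} → List A → (A → ℕ) → ℕ
∑ xs f = sum (map f xs)

∑-mono : {A : Set} (xs : List A) {f g : A → ℕ} →
         (∀ {x} → x ∈ xs → f x ≤ g x) → ∑ xs f ≤ ∑ xs g
∑-mono []       _   = z≤n
∑-mono (x ∷ xs) f≤g = +-mono-≤ (f≤g (here refl)) (∑-mono xs (f≤g ∘ there))

∑-++ : {A : Set} (xs ys : List A) (f : A → ℕ) → ∑ (xs ++ ys) f ≡ ∑ xs f + ∑ ys f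
∑-++ []       ys f = refl
∑-++ (x ∷ xs) ys f = trans (cong (f x +_) (∑-++ xs ys f)) (sym (+-assoc (f x) _ _))

∑-map : {A B : Set} (g : A → B) (xs : List A) (f : B → ℕ) → ∑ (map g xs) f ≡ ∑ xs (f ∘ g)
∑-map g []       f = refl
∑-map g (x ∷ xs) f = cong (f (g x) +_) (∑-map g xs f)

∑-+ : {A : Set} (xs : List A) (f g : A → ℕ) → ∑ xs (λ x → f x + g x) ≡ ∑ xs f + ∑ xs g
∑-+ []       f g = refl
∑-+ (x ∷ xs) f g = trans (cong (f x + g x +_) (∑-+ xs f g)) (lemma (f x) (g x) _ _)
  where
  lemma : ∀ a b c d → a + b + (c + d) ≡ a + c + (b + d)
  lemma = solve-∀

∑-*ˡ : {A : Set} (xs : List A) (c : ℕ) (f : A → ℕ) → ∑ xs (λ x → c * f x) ≡ c * ∑ xs f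
∑-*ˡ []       c f = sym (*-zeroʳ c)
∑-*ˡ (x ∷ xs) c f = trans (cong (c * f x +_) (∑-*ˡ xs c f)) (sym (*-distribˡ-+ c (f x) _))

∑-const : {A : Set} (xs : List A) (c : ℕ) → ∑ xs (const c) ≡ length xs * c
∑-const []       c = refl
∑-const (x ∷ xs) c = cong (c +_) (∑-const xs c)

∑-bound : {A : Set} (xs : List A) {f : A → ℕ} (c : ℕ) →
          (∀ {x} → x ∈ xs → f x ≤ c) → ∑ xs f ≤ length xs * c
∑-bound xs c f≤c = ≤-trans (∑-mono xs f≤c) (≤-reflexive (∑-const xs c))

∑-swap : {A B : Set} (xs : List A) (ys : List B) (f : A → B → ℕ) →
         ∑ xs (λ x → ∑ ys (f x)) ≡ ∑ ys (λ y → ∑ xs (λ x → f x y))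
∑-swap []       ys f = sym (trans (∑-const ys 0) (*-zeroʳ (length ys)))
∑-swap (x ∷ xs) ys f =
  trans (cong (∑ ys (f x) +_) (∑-swap xs ys f)) (sym (∑-+ ys (f x) _))

∑-∈ : {A : Set} {x : A} {xs : List A} (f : A → ℕ) → x ∈ xs → f x ≤ ∑ xs f
∑-∈ f (here refl)  = m≤m+n _ _
∑-∈ f (there x∈xs) = ≤-trans (∑-∈ f x∈xs) (m≤n+m _ _)

∑-filter : {A : Set} {P : A → Set} (P? : Decidable P) (xs : List A) (f : A → ℕ) →
           ∑ xs f ≡ ∑ (filter P? xs) f + ∑ (filter (∁? P?) xs) f
∑-filter P? []       f = refl
∑-filter P? (x ∷ xs) f with P? x
... | yes _ = trans (cong (f x +_) (∑-filter P? xs f)) (sym (+-assoc (f x) _ _))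
... | no  _ =
  trans (cong (f x +_) (∑-filter P? xs f)) (lemma (f x) (∑ (filter P? xs) f) (∑ (filter (∁? P?) xs) f))
  where
  lemma : ∀ a b c → a + (b + c) ≡ b + (a + c)
  lemma = solve-∀

-- Uniqueness makes the inclusion one of multisets: the head of `xs` is cut out of `ys`, and as it
-- does not recur, the tail of `xs` still lies in what is left.
∑-⊆ : {A : Set} {xs ys : List A} (f : A → ℕ) → Unique xs → xs ⊆ ys → ∑ xs f ≤ ∑ ys f
∑-⊆ {xs = []}     f _          _   = z≤n
∑-⊆ {xs = x ∷ xs} f (x∉ ∷ uxs) sub with ∈-∃++ (sub (here refl))
... | as , bs , refl = begin
  f x + ∑ xs f          ≤⟨ +-monoʳ-≤ (f x) (∑-⊆ f uxs sub′) ⟩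
  f x + ∑ (as ++ bs) f  ≡⟨ cong (f x +_) (∑-++ as bs f) ⟩
  f x + (∑ as f + ∑ bs f) ≡⟨ lemma (f x) (∑ as f) _ ⟩
  ∑ as f + (f x + ∑ bs f) ≡⟨ ∑-++ as (x ∷ bs) f ⟨
  ∑ (as ++ x ∷ bs) f    ∎
  where
  open ≤-Reasoning
  lemma : ∀ a b c → a + (b + c) ≡ b + (a + c)
  lemma = solve-∀
  sub′ : xs ⊆ as ++ bs
  sub′ y∈ with ∈-++⁻ as (sub (there y∈))
  ... | inj₁ y∈as         = ∈-++⁺ˡ y∈as
  ... | inj₂ (here refl)  = contradiction refl (All.lookup x∉ y∈)
  ... | inj₂ (there y∈bs) = ∈-++⁺ʳ as y∈bs

length-∑ : {A : Set} (xs : List A) → length xs ≡ ∑ xs (const 1)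
length-∑ xs = sym (trans (∑-const xs 1) (*-identityʳ _))

length-⊆ : {A : Set} {xs ys : List A} → Unique xs → xs ⊆ ys → length xs ≤ length ys
length-⊆ {xs = xs} {ys} uxs sub =
  subst₂ _≤_ (sym (length-∑ xs)) (sym (length-∑ ys)) (∑-⊆ (const 1) uxs sub)

fresh : {A : Set} → DecidableEquality A → {xs : List A} → Unique xs →
        (ys : List A) → length ys < length xs → ∃[ x ] x ∈ xs × x ∉ ys
fresh _≟_ {xs} uxs ys ys<xs with Any.any? (λ x → ¬? (Any.any? (x ≟_) ys)) xs
... | yes p = find p
... | no ¬p = contradiction (length-⊆ uxs sub) (<⇒≱ ys<xs)
  where
  sub : xs ⊆ ys
  sub {x} x∈xs with Any.any? (x ≟_) ys
  ... | yes x∈ys = x∈ys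
  ... | no  x∉ys = contradiction (lose x∈xs x∉ys) ¬p

unique-map : {A B : Set} (f : A → B) {xs : List A} →
             (∀ {x y} → x ∈ xs → y ∈ xs → f x ≡ f y → x ≡ y) → Unique xs → Unique (map f xs)
unique-map f             inj []         = []
unique-map f {x ∷ xs} inj (x∉ ∷ uxs) =
  All.tabulate (λ y∈ fx≡y → let x′ , x′∈ , y≡ = ∈-map⁻ f y∈ in
    All.lookup x∉ x′∈ (inj (here refl) (there x′∈) (trans fx≡y y≡)))
  ∷ unique-map f (λ x∈ y∈ → inj (there x∈) (there y∈)) uxs

-- Deleting keys of small degree until a dense part or nothing remains.

module Peeling {A K : Set} (ks : List K) (ks-complete : ∀ κ → κ ∈ ks)
               (inc : K → A → Set) (inc? : ∀ κ a → Dec (inc κ a)) (M : ℕ) where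

  deg : K → List A → ℕ
  deg κ E = length (filter (inc? κ) E)

  -- The condition concerns occurring keys only, since keys that have been peeled off keep degree
  -- zero.
  Dense : List A → Set
  Dense E = ∀ κ → Any (inc κ) E → M < deg κ E

  -- A certificate of degeneracy, with the keys listed in the order of their removal.
  data Peeled : List K → List A → Set where
    done : Peeled [] []
    peel : ∀ {κ κs E} → deg κ E ≤ M → Any (inc κ) E →
           Peeled κs (filter (∁? (inc? κ)) E) → Peeled (κ ∷ κs) E

  peeling : ∀ E → Unique E →
            (∃[ E′ ] E′ ≢ [] × E′ ⊆ E × Unique E′ × Dense E′) ⊎ ∃[ κs ] Peeled κs E
  peeling E uE = go E uE (<-wellFounded (length E))
    where
    go : ∀ E → Unique E → Acc _<_ (length E) →
         (∃[ E′ ] E′ ≢ [] × E′ ⊆ E × Unique E′ × Dense E′) ⊎ ∃[ κs ] Peeled κs E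
    go []      uE _ = inj₂ ([] , done)
    go E@(_ ∷ _) uE (acc rec)
      with Any.any? (λ κ → Any.any? (inc? κ) E ×-dec (deg κ E ≤? M)) ks
    ... | no none = inj₁ (E , (λ ()) , (λ x → x) , uE ,
                          λ κ κ∈ → ≰⇒> λ d≤M → none (lose (ks-complete κ) (κ∈ , d≤M)))
    ... | yes some with Any.satisfied some
    ... | κ , κ∈ , d≤M
      with go (filter (∁? (inc? κ)) E) (Unique.filter⁺ (∁? (inc? κ)) uE)
              (rec (filter-notAll (∁? (inc? κ)) E (Any.map (λ i ¬i → ¬i i) κ∈)))
    ... | inj₂ (κs , p) = inj₂ (κ ∷ κs , peel d≤M κ∈ p)
    ... | inj₁ (E′ , E′≢ , E′⊆ , rest) =
      inj₁ (E′ , E′≢ , (λ x∈ → proj₁ (∈-filter⁻ (∁? (inc? κ)) (E′⊆ x∈))) , rest)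

  peeled-incident : ∀ {κs E κ} → Peeled κs E → κ ∈ κs → Any (inc κ) E
  peeled-incident (peel _ κ∈ _) (here refl) = κ∈
  peeled-incident (peel {κ = κ′} _ _ p) (there κ∈) =
    let a , a∈ , i = find (peeled-incident p κ∈) in
    lose (proj₁ (∈-filter⁻ (∁? (inc? κ′)) a∈)) i

  -- Nothing incident to a peeled key survives, whereas each key is incident to something at the
  -- moment of its removal.
  peeled-unique : ∀ {κs E} → Peeled κs E → Unique κs
  peeled-unique done = []
  peeled-unique (peel {κ} {κs} {E} _ _ p) = All.tabulate fresh-key ∷ peeled-unique p
    where
    fresh-key : ∀ {κ′} → κ′ ∈ κs → κ ≢ κ′
    fresh-key κ′∈ refl =
      let a , a∈ , i = find (peeled-incident p κ′∈) in
      proj₂ (∈-filter⁻ (∁? (inc? κ)) {xs = E} a∈) i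

  -- Each element is charged to the key that removes it, and a key removes at most `M` elements.
  peeled-∑ : ∀ {κs E} (wt : A → ℕ) (cost : K → ℕ) →
             (∀ κ a → inc κ a → wt a ≤ cost κ) → Peeled κs E → ∑ E wt ≤ M * ∑ κs cost
  peeled-∑ wt cost w≤c done = z≤n
  peeled-∑ wt cost w≤c (peel {κ} {κs} {E} d≤M _ p) = begin
    ∑ E wt
      ≡⟨ ∑-filter (inc? κ) E wt ⟩
    ∑ (filter (inc? κ) E) wt + ∑ (filter (∁? (inc? κ)) E) wt
      ≤⟨ +-mono-≤ (∑-bound (filter (inc? κ) E) (cost κ)
                     (λ a∈ → w≤c κ _ (proj₂ (∈-filter⁻ (inc? κ) {xs = E} a∈))))
                  (peeled-∑ wt cost w≤c p) ⟩
    deg κ E * cost κ + M * ∑ κs cost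
      ≤⟨ +-monoˡ-≤ _ (*-monoˡ-≤ (cost κ) d≤M) ⟩
    M * cost κ + M * ∑ κs cost
      ≡⟨ *-distribˡ-+ M (cost κ) (∑ κs cost) ⟨
    M * ∑ (κ ∷ κs) cost ∎
    where open ≤-Reasoning

  peeled-length : ∀ {κs E} → Peeled κs E → length E ≤ M * length κs
  peeled-length {κs} {E} p = subst₂ (λ a b → a ≤ M * b) (sym (length-∑ E)) (sym (length-∑ κs))
    (peeled-∑ (const 1) (const 1) (λ _ _ _ → ≤-refl) p)

-- Indicators of decidable propositions.

⟦_⟧ : {P : Set} → Dec P → ℕ
⟦ yes _ ⟧ = 1
⟦ no  _ ⟧ = 0

⟦⟧-true : {P : Set} {p? : Dec P} → P → ⟦ p? ⟧ ≡ 1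
⟦⟧-true {p? = yes _} _ = refl
⟦⟧-true {p? = no ¬p} p = contradiction p ¬p

⟦⟧-≤ : {P : Set} {p? : Dec P} {n : ℕ} → (P → 1 ≤ n) → ⟦ p? ⟧ ≤ n
⟦⟧-≤ {p? = yes p} h = h p
⟦⟧-≤ {p? = no  _} h = z≤n

1≤⟦⟧ : {P : Set} {p? : Dec P} → P → 1 ≤ ⟦ p? ⟧
1≤⟦⟧ p = ≤-reflexive (sym (⟦⟧-true p))

⟦⟧-pos : {P : Set} {p? : Dec P} → 1 ≤ ⟦ p? ⟧ → P
⟦⟧-pos {p? = yes p} _ = p

⟦⟧-cong : {P Q : Set} {p? : Dec P} {q? : Dec Q} → (P → Q) → (Q → P) → ⟦ p? ⟧ ≡ ⟦ q? ⟧
⟦⟧-cong to from = ≤-antisym (⟦⟧-≤ (1≤⟦⟧ ∘ to)) (⟦⟧-≤ (1≤⟦⟧ ∘ from))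

∑-cong : {A : Set} (xs : List A) {f g : A → ℕ} → (∀ x → f x ≡ g x) → ∑ xs f ≡ ∑ xs g
∑-cong xs f≡g = ≤-antisym (∑-mono xs (λ _ → ≤-reflexive (f≡g _)))
                          (∑-mono xs (λ _ → ≤-reflexive (sym (f≡g _))))

∑-pos : {A : Set} (xs : List A) {f : A → ℕ} → 1 ≤ ∑ xs f → ∃[ x ] x ∈ xs × 1 ≤ f x
∑-pos (x ∷ xs) {f} p with f x in eq
... | suc _ = x , here refl , subst (1 ≤_) (sym eq) (s≤s z≤n)
... | zero  = let y , y∈ , q = ∑-pos xs p in y , there y∈ , q

∑-≟ : {A : Set} (_≟_ : DecidableEquality A) {xs : List A} (z : A) →
      Unique xs → ∑ xs (λ x → ⟦ x ≟ z ⟧) ≤ 1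
∑-≟ _≟_ z [] = z≤n
∑-≟ _≟_ {x ∷ xs} z (x∉ ∷ uxs) with x ≟ z
... | no _ = ∑-≟ _≟_ z uxs
... | yes refl = s≤s (≤-trans (∑-bound xs 0 zeros) (≤-reflexive (*-zeroʳ (length xs))))
  where
  zeros : ∀ {y} → y ∈ xs → ⟦ y ≟ x ⟧ ≤ 0
  zeros y∈ = ⟦⟧-≤ (λ y≡x → contradiction (sym y≡x) (All.lookup x∉ y∈))

-- Sums over walks, and the number of clean walks with ends that are not rich.

module Walks {V : Set} (_≟_ : DecidableEquality V) (vs : List V) (vs-complete : ∀ v → v ∈ vs)
             (N : V → List V) (N-unique : ∀ v → Unique (N v))
             (D : ℕ) (N≤D : ∀ v → length (N v) ≤ D) (Q : ℕ) where

  Seq : Set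
  Seq = ℕ → V

  infixr 5 _◂_
  _◂_ : V → Seq → Seq
  (v ◂ x) zero    = v
  (v ◂ x) (suc n) = x n

  Walk : ℕ → V → Seq → Set
  Walk i v x = x 0 ≡ v × (∀ j → j < i → x (suc j) ∈ N (x j))

  walk-◂ : ∀ {i u v x} → u ∈ N v → Walk i u x → Walk (suc i) v (v ◂ x)
  walk-◂ {v = v} u∈ (x0 , step) = refl , λ
    { zero    _         → subst (_∈ N v) (sym x0) u∈
    ; (suc j) (s≤s j<i) → step j j<i }

  Agree : ℕ → Seq → Seq → Set
  Agree i x y = ∀ n → n ≤ i → x n ≡ y n

  -- The hypothesis under which a factor belonging to the first part of a walk can be separated from
  -- the rest, as in `∫-split`.
  Local : ℕ → (Seq → ℕ) → Set
  Local i f = ∀ x y → Agree i x y → f x ≡ f y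

  local-◂ : ∀ {i f} v → Local (suc i) f → Local i (f ∘ (v ◂_))
  local-◂ v loc x y x≈y = loc _ _ λ { zero _ → refl ; (suc n) (s≤s n≤i) → x≈y n n≤i }

  opaque
    -- ∫ i v f sums f over the walks v = x₀, x₁, …, xᵢ, where xⱼ₊₁ ∈ N xⱼ; a
    -- walk is an infinite sequence of which only the first i + 1 terms matter.
    ∫ : ℕ → V → (Seq → ℕ) → ℕ
    ∫ zero    v f = f (const v)
    ∫ (suc i) v f = ∑ (N v) λ u → ∫ i u (λ x → f (v ◂ x))

    ∫-mono : ∀ i v {f g : Seq → ℕ} → (∀ x → Walk i v x → f x ≤ g x) → ∫ i v f ≤ ∫ i v g
    ∫-mono zero    v f≤g = f≤g (const v) (refl , λ _ ())
    ∫-mono (suc i) v f≤g =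
      ∑-mono (N v) λ u∈ → ∫-mono i _ λ x w → f≤g (v ◂ x) (walk-◂ u∈ w)

    ∫-∑ : ∀ {A : Set} i v (es : List A) (F : A → Seq → ℕ) →
          ∫ i v (λ x → ∑ es (λ e → F e x)) ≡ ∑ es (λ e → ∫ i v (F e))
    ∫-∑ zero    v es F = refl
    ∫-∑ (suc i) v es F =
      trans (∑-cong (N v) λ u → ∫-∑ i u es (λ e x → F e (v ◂ x)))
            (∑-swap (N v) es λ u e → ∫ i u (λ x → F e (v ◂ x)))

    ∫-+ : ∀ i v (f g : Seq → ℕ) → ∫ i v (λ x → f x + g x) ≡ ∫ i v f + ∫ i v g
    ∫-+ zero    v f g = refl
    ∫-+ (suc i) v f g =
      trans (∑-cong (N v) λ u → ∫-+ i u (f ∘ (v ◂_)) (g ∘ (v ◂_))) (∑-+ (N v) _ _)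

    ∫-*ˡ : ∀ i v c (f : Seq → ℕ) → ∫ i v (λ x → c * f x) ≡ c * ∫ i v f
    ∫-*ˡ zero    v c f = refl
    ∫-*ˡ (suc i) v c f = trans (∑-cong (N v) λ u → ∫-*ˡ i u c (f ∘ (v ◂_))) (∑-*ˡ (N v) c _)

    ∫-1≤ : ∀ i v → ∫ i v (const 1) ≤ D ^ i
    ∫-1≤ zero    v = ≤-refl
    ∫-1≤ (suc i) v = ≤-trans (∑-bound (N v) (D ^ i) λ {u} _ → ∫-1≤ i u) (*-monoˡ-≤ (D ^ i) (N≤D v))

    -- Degree `D` is asked of the start and of out-neighbours only, since a walk visits no other
    -- vertices; those outside the chosen subgraph may have smaller degree.
    ∫-≥1 : (∀ {u v} → u ∈ N v → length (N u) ≡ D) →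
           ∀ i {v} → length (N v) ≡ D → D ^ i ≤ ∫ i v (const 1)
    ∫-≥1 regular zero    _   = ≤-refl
    ∫-≥1 regular (suc i) {v} len = begin
      D * D ^ i                       ≡⟨ cong (_* D ^ i) len ⟨
      length (N v) * D ^ i            ≡⟨ ∑-const (N v) (D ^ i) ⟨
      ∑ (N v) (const (D ^ i))         ≤⟨ ∑-mono (N v) (λ u∈ → ∫-≥1 regular i (regular u∈)) ⟩
      ∫ (suc i) v (const 1)           ∎
      where open ≤-Reasoning

    ∫-pos : ∀ i v {f : Seq → ℕ} → 1 ≤ ∫ i v f → ∃[ x ] Walk i v x × 1 ≤ f x
    ∫-pos zero    v p = const v , (refl , λ _ ()) , p
    ∫-pos (suc i) v p =
      let u , u∈ , q = ∑-pos (N v) p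
          x , w , r  = ∫-pos i u q
      in v ◂ x , walk-◂ u∈ w , r

    ∫-0 : ∀ v (f : Seq → ℕ) → ∫ 0 v f ≡ f (const v)
    ∫-0 v f = refl

    -- Once the first `j` steps are fixed, the remaining `l` contribute at most `B`, whichever
    -- vertex has been reached.
    ∫-split : ∀ j {l} v {f g : Seq → ℕ} {B} → Local j f → (∀ y → ∫ l y g ≤ B) →
              ∫ (j + l) v (λ x → f x * g (λ n → x (j + n))) ≤ ∫ j v f * B
    ∫-split zero {l} v {f} {g} {B} loc g≤B = begin
      ∫ l v (λ x → f x * g x)
        ≤⟨ ∫-mono l v (λ x (x0 , _) →
             ≤-reflexive (cong (_* g x) (loc x (const v) λ { zero z≤n → x0 }))) ⟩
      ∫ l v (λ x → f (const v) * g x)  ≡⟨ ∫-*ˡ l v (f (const v)) g ⟩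
      f (const v) * ∫ l v g            ≤⟨ *-monoʳ-≤ (f (const v)) (g≤B v) ⟩
      f (const v) * B                  ∎
      where open ≤-Reasoning
    ∫-split (suc j) {l} v {f} {g} {B} loc g≤B = begin
      ∑ (N v) (λ u → ∫ (j + l) u (λ x → f (v ◂ x) * g (λ n → x (j + n))))
        ≤⟨ ∑-mono (N v) (λ {u} _ → ∫-split j u (local-◂ v loc) g≤B) ⟩
      ∑ (N v) (λ u → ∫ j u (λ x → f (v ◂ x)) * B)
        ≡⟨ ∑-cong (N v) (λ u → *-comm _ B) ⟩
      ∑ (N v) (λ u → B * ∫ j u (λ x → f (v ◂ x)))
        ≡⟨ ∑-*ˡ (N v) B _ ⟩
      B * ∫ (suc j) v f
        ≡⟨ *-comm B _ ⟩
      ∫ (suc j) v f * B ∎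
      where open ≤-Reasoning

    ∫-last : ∀ i v {f : Seq → ℕ} {h : V → ℕ} {B} → Local i f → (∀ y → ∑ (N y) h ≤ B) →
             ∫ (suc i) v (λ x → f x * h (x (suc i))) ≤ ∫ i v f * B
    ∫-last i v {f} {h} {B} loc h≤B =
      subst (λ k → ∫ k v (λ x → f x * h (x k)) ≤ ∫ i v f * B) (+-comm i 1)
            (∫-split i v {g = λ x → h (x 1)} loc h≤B)

  local-at : ∀ i u → Local i (λ x → ⟦ x i ≟ u ⟧)
  local-at i u x y x≈y = cong (λ w → ⟦ w ≟ u ⟧) (x≈y i ≤-refl)

  -- Clean i and Rich i concern walks of length 1 + i, Super i walks of length i.
  -- Rich zero is empty: a single edge has no interior vertices, and edges must
  -- not count as rich.
  Super  : ℕ → Seq → Set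
  Clean  : ℕ → Seq → Set
  Rich   : ℕ → V → V → Set
  super? : ∀ i x → Dec (Super i x)
  clean? : ∀ i x → Dec (Clean i x)
  rich?  : ∀ i a z → Dec (Rich i a z)
  #clean : ℕ → V → V → ℕ
  #cleanVia : ℕ → V → V → ℕ → V → ℕ

  Super zero    x = ⊤
  Super (suc i) x = Clean i x × ¬ Rich i (x 0) (x (suc i))

  Clean i x = Super i x × Super i (x ∘ suc) × x 0 ≢ x (suc i)

  Rich zero    a z = ⊥
  Rich (suc i) a z = (p : Fin (suc i)) →
    All (λ u → Q * #cleanVia (suc i) a z (suc (toℕ p)) u ≤ #clean (suc i) a z) vs

  #clean i a z        = ∫ (suc i) a λ x → ⟦ clean? i x ×-dec (x (suc i) ≟ z) ⟧
  #cleanVia i a z p u = ∫ (suc i) a λ x → ⟦ clean? i x ×-dec (x (suc i) ≟ z) ×-dec (x p ≟ u) ⟧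

  super? zero    x = yes tt
  super? (suc i) x = clean? i x ×-dec ¬? (rich? i (x 0) (x (suc i)))

  clean? i x = super? i x ×-dec super? i (x ∘ suc) ×-dec ¬? (x 0 ≟ x (suc i))

  rich? zero    a z = no λ ()
  rich? (suc i) a z = Fin.all? λ p →
    All.all? (λ u → Q * #cleanVia (suc i) a z (suc (toℕ p)) u ≤? #clean (suc i) a z) vs

  -- The interior positions of a walk of length `2 + i` are `1` to `suc i`, hence the shift to
  -- `suc p`.
  rich-via : ∀ {i a z} → Rich (suc i) a z → ∀ {p} → p < suc i → ∀ u →
             Q * #cleanVia (suc i) a z (suc p) u ≤ #clean (suc i) a z
  rich-via {i} {a} {z} r {p} p<i u =
    subst (λ q → Q * #cleanVia (suc i) a z (suc q) u ≤ #clean (suc i) a z)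
          (Fin.toℕ-fromℕ< p<i) (All.lookup (r (fromℕ< p<i)) (vs-complete u))

  ¬rich-via : ∀ {i a z} → ¬ Rich (suc i) a z →
              ∃₂ λ p u → p < suc i × #clean (suc i) a z < Q * #cleanVia (suc i) a z (suc p) u
  ¬rich-via {i} {a} {z} ¬r =
    let p , ¬all = Fin.¬∀⟶∃¬ (suc i) _ (λ p → All.all? (λ u → _ ≤? _) vs) ¬r
        u , _ , ¬≤ = find (All.¬All⇒Any¬ (λ u → _ ≤? _) vs ¬all)
    in toℕ p , u , Fin.toℕ<n p , ≰⇒> ¬≤

  super-cong : ∀ i {x y} → Agree i x y → Super i x → Super i y
  super-cong zero    x≈y _ = tt
  super-cong (suc i) {x} {y} x≈y ((s , s′ , ≢) , ¬r) =
    (super-cong i (λ n n≤i → x≈y n (m≤n⇒m≤1+n n≤i)) s ,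
     super-cong i (λ n n≤i → x≈y (suc n) (s≤s n≤i)) s′ ,
     λ eq → ≢ (trans (x≈y 0 z≤n) (trans eq (sym (x≈y (suc i) ≤-refl))))) ,
    λ r → ¬r (subst₂ (Rich i) (sym (x≈y 0 z≤n)) (sym (x≈y (suc i) ≤-refl)) r)

  agree-sym : ∀ {i x y} → Agree i x y → Agree i y x
  agree-sym x≈y n n≤i = sym (x≈y n n≤i)

  -- `Clean` tests only the two subwalks obtained by dropping one end vertex. By recursion, this
  -- lemma and `super-suffix` together reach all other subwalks.
  super-prefix : ∀ {i j x} → j ≤′ i → Super i x → Super j x
  super-prefix (≤′-reflexive refl) s = s
  super-prefix (≤′-step j≤i) ((s , _) , _) = super-prefix j≤i s

  super-suffix : ∀ a {j x} → Super (a + j) x → Super j (λ n → x (a + n))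
  super-suffix zero    s = s
  super-suffix (suc a) ((_ , s , _) , _) = super-suffix a s

  -- Positions `a` and `b` are the ends of a subwalk that is itself super, and super walks of
  -- positive length have distinct ends.
  super-≢ : ∀ {i x} → Super i x → ∀ {a b} → a < b → b ≤ i → x a ≢ x b
  super-≢ {x = x} s {a} {b} a<b b≤i with m≤n⇒∃[o]m+o≡n a<b
  ... | o , refl
    with super-suffix a (super-prefix (≤⇒≤′ (≤-trans (≤-reflexive (+-suc a o)) b≤i)) s)
  ... | (_ , _ , ≢) , _ =
    λ eq → ≢ (trans (cong x (+-identityʳ a)) (trans eq (cong x (sym (+-suc a o)))))

  -- Strong induction on the length. If the ends are not rich, fewer than `Q` times as many clean
  -- walks exist as pass through some `u` at position `suc p`. Both halves at `u` are super, so the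
  -- count is at most `Q * (Q ^ p * Q ^ l)` with `p + l ≡ i`, which is the claimed power.
  super-count : 1 ≤ Q → ∀ i a z → ∫ (suc i) a (λ x → ⟦ super? (suc i) x ×-dec (x (suc i) ≟ z) ⟧) ≤ Q ^ i
  super-count 1≤Q = <-rec _ go
    where
    open ≤-Reasoning
    S : ℕ → V → V → ℕ
    S i a z = ∫ (suc i) a (λ x → ⟦ super? (suc i) x ×-dec (x (suc i) ≟ z) ⟧)
    go : ∀ i → (∀ {j} → j < i → ∀ a z → S j a z ≤ Q ^ j) → ∀ a z → S i a z ≤ Q ^ i
    go zero rec a z = begin
      S 0 a z
        ≤⟨ ∫-mono 1 a (λ x _ → ⟦⟧-≤ (λ (_ , e) → ≤-trans (1≤⟦⟧ e) (≤-reflexive (sym (*-identityˡ _))))) ⟩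
      ∫ 1 a (λ x → 1 * ⟦ x 1 ≟ z ⟧)
        ≤⟨ ∫-last 0 a {f = const 1} (λ _ _ _ → refl) (λ y → ∑-≟ _≟_ z (N-unique y)) ⟩
      ∫ 0 a (const 1) * 1                       ≡⟨ cong (_* 1) (∫-0 a (const 1)) ⟩
      1 ∎
    go (suc i) rec a z = branch (rich? (suc i) a z)
      where
      dense : ∀ {i p u l} → (∀ {j} → j < suc i → ∀ a z → S j a z ≤ Q ^ j) → p + l ≡ i →
              #clean (suc i) a z < Q * #cleanVia (suc i) a z (suc p) u →
              S (suc i) a z ≤ Q ^ suc i
      dense {_} {p} {u} {l} rec refl few = begin
        S (suc (p + l)) a z
          ≤⟨ ∫-mono (suc (suc (p + l))) a (λ x _ → ⟦⟧-≤ (λ ((c , _) , e) → 1≤⟦⟧ (c , e))) ⟩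
        #clean (suc (p + l)) a z                  ≤⟨ <⇒≤ few ⟩
        Q * #cleanVia (suc (p + l)) a z (suc p) u ≤⟨ *-monoʳ-≤ Q via ⟩
        Q * (Q ^ p * Q ^ l)                       ≡⟨ cong (Q *_) (sym (^-distribˡ-+-* Q p l)) ⟩
        Q ^ suc (p + l) ∎
        where
        f g : Seq → ℕ
        f x = ⟦ super? (suc p) x ×-dec (x (suc p) ≟ u) ⟧
        g x = ⟦ super? (suc l) x ×-dec (x (suc l) ≟ z) ⟧
        local-f : Local (suc p) f
        local-f x y x≈y = ⟦⟧-cong
          (λ (s , e) → super-cong (suc p) x≈y s , trans (sym (x≈y (suc p) ≤-refl)) e)
          (λ (s , e) → super-cong (suc p) (agree-sym x≈y) s , trans (x≈y (suc p) ≤-refl) e)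
        -- The position of the end vertex is a parameter so that it can be rewritten together with
        -- the length of the walk.
        through : ℕ → Seq → ℕ
        through k x = ⟦ clean? (suc (p + l)) x ×-dec (x k ≟ z) ×-dec (x (suc p) ≟ u) ⟧
        via : #cleanVia (suc (p + l)) a z (suc p) u ≤ Q ^ p * Q ^ l
        via = begin
          ∫ (suc (suc (p + l))) a (through (suc (suc (p + l))))
            ≡⟨ cong (λ k → ∫ (suc k) a (through (suc k))) (sym (+-suc p l)) ⟩
          ∫ (suc p + suc l) a (through (suc p + suc l))
            ≤⟨ ∫-mono (suc p + suc l) a (λ x _ → ⟦⟧-≤ (λ ((s , s′ , _) , e , e′) →
                 *-mono-≤
                   (1≤⟦⟧ {p? = super? (suc p) x ×-dec (x (suc p) ≟ u)}
                     (super-prefix (≤⇒≤′ (s≤s (m≤m+n p l))) s , e′))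
                   (1≤⟦⟧ {p? = super? (suc l) (λ n → x (suc p + n)) ×-dec (x (suc p + suc l) ≟ z)}
                     (super-suffix p (subst (λ k → Super k (x ∘ suc)) (sym (+-suc p l)) s′) , e)))) ⟩
          ∫ (suc p + suc l) a (λ x → f x * g (λ n → x (suc p + n)))
            ≤⟨ ∫-split (suc p) a {f} {g} local-f (λ y → rec (s≤s (m≤n+m l p)) y z) ⟩
          S p a u * Q ^ l
            ≤⟨ *-monoˡ-≤ (Q ^ l) (rec (s≤s (m≤m+n p l)) a u) ⟩
          Q ^ p * Q ^ l ∎
      branch : Dec (Rich (suc i) a z) → S (suc i) a z ≤ Q ^ suc i
      branch (yes r) = begin
        S (suc i) a z
          ≤⟨ ∫-mono (suc (suc i)) a (λ x (x0 , _) → ⟦⟧-≤ (λ ((_ , ¬r) , e) →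
               contradiction (subst₂ (Rich (suc i)) (sym x0) (sym e) r) ¬r)) ⟩
        -- The zero integrand is written as a product so that `∫-*ˡ` evaluates the sum.
        ∫ (suc (suc i)) a (λ _ → 0 * 0)           ≡⟨ ∫-*ˡ (suc (suc i)) a 0 (const 0) ⟩
        0                                         ≤⟨ z≤n ⟩
        Q ^ suc i ∎
      branch (no ¬r) =
        let p , u , p<i , few = ¬rich-via ¬r
            l , p+l≡i         = m≤n⇒∃[o]m+o≡n (≤-pred p<i)
        in dense rec p+l≡i few

-- Paths avoiding given vertices, and theta graphs from linked pairs.

extend : {V : Set} → ℕ → (ℕ → V) → V → ℕ → V
extend j       x y zero    = x 0
extend zero    x y (suc n) = y
extend (suc j) x y (suc n) = extend j (x ∘ suc) y n

extend-≤ : ∀ {V : Set} {j} {x : ℕ → V} {y n} → n ≤ j → extend j x y n ≡ x n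
extend-≤ {n = zero}                _         = refl
extend-≤ {j = suc j} {n = suc n}   (s≤s n≤j) = extend-≤ n≤j

extend-last : ∀ {V : Set} j {x : ℕ → V} {y} → extend j x y (suc j) ≡ y
extend-last zero    = refl
extend-last (suc j) = extend-last j

module Paths {V : Set} (adj : V → V → Set) where

  IsPath : ℕ → V → V → (ℕ → V) → Set
  IsPath k a b x = x 0 ≡ a × x k ≡ b ×
    (∀ j → j < k → adj (x j) (x (suc j))) ×
    (∀ {i j} → i < j → j ≤ k → x i ≢ x j)

  Avoids : ℕ → (ℕ → V) → List V → Set
  Avoids k x U = ∀ j → 0 < j → j < k → x j ∉ U

  PathAvoiding : ℕ → V → V → List V → Set
  PathAvoiding k a b U = ∃[ x ] IsPath k a b x × Avoids k x U

  Linked : ℕ → ℕ → V → V → Set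
  Linked k s a b = ∀ U → length U ≤ s → PathAvoiding k a b U

  ≤-suc-cases : ∀ {i j} → i ≤ suc j → i ≤ j ⊎ i ≡ suc j
  ≤-suc-cases i≤ with m≤n⇒m<n∨m≡n i≤
  ... | inj₁ (s≤s i≤j) = inj₁ i≤j
  ... | inj₂ i≡        = inj₂ i≡

  -- Having `b` on the avoided list keeps the interior of the shorter path away from the new end.
  -- The old end `c` becomes an interior vertex, so it has to lie outside `U` as well.
  path-extend : ∀ {k a c b U} → PathAvoiding k a c (b ∷ U) → a ≢ b → c ∉ b ∷ U → adj c b →
                PathAvoiding (suc k) a b U
  path-extend {k} {a} {c} {b} {U} (x , (x0 , xk , steps , distinct) , avoids) a≢b c∉ c~b =
    y , (x0 , extend-last k , steps′ , distinct′) , avoids′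
    where
    y : ℕ → V
    y = extend k x b
    old : ∀ {n} → n ≤ k → x n ≢ b
    old {zero}  n≤k eq = a≢b (trans (sym x0) eq)
    old {suc n} n≤k eq with m≤n⇒m<n∨m≡n n≤k
    ... | inj₁ n<k  = avoids (suc n) (s≤s z≤n) n<k (here eq)
    ... | inj₂ refl = c∉ (here (trans (sym xk) eq))
    steps′ : ∀ j → j < suc k → adj (y j) (y (suc j))
    steps′ j (s≤s j≤k) with m≤n⇒m<n∨m≡n j≤k
    ... | inj₁ j<k  = subst₂ adj (sym (extend-≤ j≤k)) (sym (extend-≤ j<k)) (steps j j<k)
    ... | inj₂ refl = subst₂ adj (sym (trans (extend-≤ j≤k) xk)) (sym (extend-last j)) c~b
    distinct′ : ∀ {i j} → i < j → j ≤ suc k → y i ≢ y j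
    distinct′ {i} {j} i<j j≤ eq with ≤-suc-cases j≤
    ... | inj₁ j≤k  = distinct i<j j≤k (trans (sym (extend-≤ (≤-trans (<⇒≤ i<j) j≤k))) (trans eq (extend-≤ j≤k)))
    ... | inj₂ refl =
      old (≤-pred i<j) (trans (sym (extend-≤ (≤-pred i<j))) (trans eq (extend-last k)))
    avoids′ : Avoids (suc k) y U
    avoids′ j 0<j (s≤s j≤k) yj∈ with m≤n⇒m<n∨m≡n j≤k
    ... | inj₁ j<k  = avoids j 0<j j<k (there (subst (_∈ U) (extend-≤ j≤k) yj∈))
    ... | inj₂ refl = c∉ (there (subst (_∈ U) (trans (extend-≤ j≤k) xk) yj∈))

  -- The path is built backwards from `y`: a neighbour `c` one level lower is chosen, and `y` joins
  -- the list of avoided vertices before the recursion to `c`. Each level thus costs one vertex,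
  -- which explains the budget `length U + p ≤ B`.
  climb : ∀ {a B i} (S : ℕ → V → Set) →
          (∀ p {y} → S p y → a ≢ y) →
          (∀ {y} → S 0 y → Linked i B a y) →
          (∀ p {y} → S (suc p) y → ∀ U → length U ≤ B → ∃[ c ] c ∉ U × S p c × adj c y) →
          ∀ p {y} → S p y → ∀ U → length U + p ≤ B → PathAvoiding (p + i) a y U
  climb S S≢a base step zero    s U U≤B = base s U (≤-trans (m≤m+n _ _) U≤B)
  climb {a} {B} {i} S S≢a base step (suc p) {y} s U U≤B =
    let U′≤B : length (y ∷ U) + p ≤ B
        U′≤B = ≤-trans (≤-reflexive (sym (+-suc (length U) p))) U≤B
        c , c∉ , s′ , c~y = step p s (y ∷ U) (≤-trans (m≤m+n _ _) U′≤B)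
    in path-extend (climb {i = i} S S≢a base step p s′ (y ∷ U) U′≤B) (S≢a (suc p) s) c∉ c~y

  ThetaIn : ℕ → ℕ → Set
  ThetaIn l t = ∃[ ι ] Injective _≡_ _≡_ ι ×
    (∀ i j → adj (ι (path i (inject₁ j))) (ι (path i (suc j))))
    where open Theta l t

  module _ {l : ℕ} {a b : V} where

    -- The list `used` is what the next path is asked to avoid; its length is recorded because
    -- `Linked` tolerates only `s` vertices.
    record System (t : ℕ) : Set where
      field
        P          : Fin t → ℕ → V
        paths      : ∀ i → IsPath (suc l) a b (P i)
        disjoint   : ∀ i j → i ≢ j → ∀ p q → p < l → q < l → P i (suc p) ≢ P j (suc q)
        used       : List V
        length-used : length used ≡ t * l
        all-used   : ∀ i p → p < l → P i (suc p) ∈ used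

    system : ∀ t {s} → t * l ≤ s → Linked (suc l) s a b → System t
    system zero    _    _    = record
      { P =
        λ () ; paths = λ () ; disjoint = λ () ; used = [] ; length-used = refl ; all-used = λ () }
    system (suc t) {s} tl≤s link = add (link used (≤-trans (≤-reflexive length-used) tl≤s′))
      where
      tl≤s′ : t * l ≤ s
      tl≤s′ = ≤-trans (m≤n+m _ l) tl≤s
      open System (system t tl≤s′ link)
      add : PathAvoiding (suc l) a b used → System (suc t)
      add (x , isPath , avoids) = record
        { P           = P′
        ; paths       = λ { zero → isPath ; (suc i) → paths i }
        ; disjoint    = disjoint′
        ; used        = applyUpTo (x ∘ suc) l ++ used
        ; length-used = trans (length-++ (applyUpTo (x ∘ suc) l))
                              (cong₂ _+_ (length-applyUpTo (x ∘ suc) l) length-used)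
        ; all-used    = λ { zero    p p<l → ∈-++⁺ˡ (∈-applyUpTo⁺ (x ∘ suc) p<l)
                          ; (suc i) p p<l → ∈-++⁺ʳ (applyUpTo (x ∘ suc) l) (all-used i p p<l) }
        }
        where
        P′ : Fin (suc t) → ℕ → V
        P′ zero    = x
        P′ (suc i) = P i
        disjoint′ : ∀ i j → i ≢ j → ∀ p q → p < l → q < l → P′ i (suc p) ≢ P′ j (suc q)
        disjoint′ zero    zero    i≢j = contradiction refl i≢j
        disjoint′ zero    (suc j) _ p q p<l q<l eq =
          avoids (suc p) (s≤s z≤n) (s≤s p<l) (subst (_∈ used) (sym eq) (all-used j q q<l))
        disjoint′ (suc i) zero    _ p q p<l q<l eq =
          avoids (suc q) (s≤s z≤n) (s≤s q<l) (subst (_∈ used) eq (all-used i p p<l))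
        disjoint′ (suc i) (suc j) i≢j = disjoint i j (i≢j ∘ cong suc)

    linked⇒theta : ∀ t {s} → t * l ≤ s → Linked (suc l) s a b → ThetaIn l t
    linked⇒theta t tl≤s link = ι , ι-injective , steps
      where
      open Theta l t
      open System (system t tl≤s link)
      -- The path that separates the ends is taken from `link`, since the system is empty for
      -- `t = 0`.
      a≢b : a ≢ b
      a≢b with link [] z≤n
      ... | x , (x0 , xk , _ , distinct) , _ =
        λ a≡b → distinct (s≤s z≤n) ≤-refl (trans x0 (trans a≡b (sym xk)))
      inner : Fin (t * l) → V
      inner q = P (proj₁ (remQuot l q)) (suc (toℕ (proj₂ (remQuot {t} l q))))
      ι : Vertex → V
      ι zero          = a
      ι (suc zero)    = b
      ι (suc (suc q)) = inner q
      inner≢a : ∀ i {p} → p < l → a ≢ P i (suc p)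
      inner≢a i p<l eq = let x0 , _ , _ , distinct = paths i in
        distinct (s≤s z≤n) (s≤s (<⇒≤ p<l)) (trans x0 eq)
      inner≢b : ∀ i {p} → p < l → b ≢ P i (suc p)
      inner≢b i p<l eq = let _ , xk , _ , distinct = paths i in
        distinct (s≤s p<l) ≤-refl (trans (sym eq) (sym xk))
      inner-injective′ : ∀ i j (p q : Fin l) → P i (suc (toℕ p)) ≡ P j (suc (toℕ q)) → i ≡ j × p ≡ q
      inner-injective′ i j p q eq with i Fin.≟ j
      ... | no i≢j = contradiction eq (disjoint i j i≢j _ _ (Fin.toℕ<n p) (Fin.toℕ<n q))
      ... | yes refl with <-cmp (toℕ p) (toℕ q)
      ...   | tri≈ _ p≡q _ = refl , Fin.toℕ-injective p≡q
      ...   | tri< p<q _ _ = let _ , _ , _ , distinct = paths i in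
        contradiction eq (distinct (s≤s p<q) (s≤s (<⇒≤ (Fin.toℕ<n q))))
      ...   | tri> _ _ q<p = let _ , _ , _ , distinct = paths i in
        contradiction (sym eq) (distinct (s≤s q<p) (s≤s (<⇒≤ (Fin.toℕ<n p))))
      inner-injective : ∀ {q q′} → inner q ≡ inner q′ → q ≡ q′
      inner-injective {q} {q′} eq =
        let i≡ , j≡ = inner-injective′ (proj₁ (remQuot l q)) (proj₁ (remQuot l q′))
                        (proj₂ (remQuot {t} l q)) (proj₂ (remQuot {t} l q′)) eq
        in trans (sym (Fin.combine-remQuot {t} l q))
                 (trans (cong₂ combine i≡ j≡) (Fin.combine-remQuot {t} l q′))
      ι-injective : Injective _≡_ _≡_ ι
      ι-injective {zero}        {zero}         eq = refl
      ι-injective {zero}        {suc zero}     eq = contradiction eq a≢b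
      ι-injective {zero}        {suc (suc q)}  eq =
        contradiction eq (inner≢a _ (Fin.toℕ<n (proj₂ (remQuot {t} l q))))
      ι-injective {suc zero}    {zero}         eq = contradiction (sym eq) a≢b
      ι-injective {suc zero}    {suc zero}     eq = refl
      ι-injective {suc zero}    {suc (suc q)}  eq =
        contradiction eq (inner≢b _ (Fin.toℕ<n (proj₂ (remQuot {t} l q))))
      ι-injective {suc (suc q)} {zero}         eq =
        contradiction (sym eq) (inner≢a _ (Fin.toℕ<n (proj₂ (remQuot {t} l q))))
      ι-injective {suc (suc q)} {suc zero}     eq =
        contradiction (sym eq) (inner≢b _ (Fin.toℕ<n (proj₂ (remQuot {t} l q))))
      ι-injective {suc (suc q)} {suc (suc q′)} eq = cong (λ w → suc (suc w)) (inner-injective eq)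
      ι-after : ∀ i {p} (w : View p) → ι (afterSource i w) ≡ P i (suc (toℕ p))
      ι-after i ‵fromℕ       = let _ , xk , _ = paths i in
        trans (sym xk) (cong (P i ∘ suc) (sym (Fin.toℕ-fromℕ l)))
      ι-after i (‵inject₁ j) =
        trans (cong (λ (i , j) → P i (suc (toℕ j))) (Fin.remQuot-combine i j))
              (cong (P i ∘ suc) (sym (Fin.toℕ-inject₁ j)))
      ι-path : ∀ i p → ι (path i p) ≡ P i (toℕ p)
      ι-path i zero    = sym (proj₁ (paths i))
      ι-path i (suc p) = ι-after i (view p)
      steps : ∀ i j → adj (ι (path i (inject₁ j))) (ι (path i (suc j)))
      steps i j = let _ , _ , adjacent , _ = paths i in
        subst₂ adj (sym (trans (ι-path i (inject₁ j)) (cong (P i) (Fin.toℕ-inject₁ j))))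
                   (sym (ι-path i (suc j)))
                   (adjacent (toℕ j) (Fin.toℕ<n j))

-- B bounds the number of vertices that a path under construction has to avoid
-- and M the number of (position, vertex) pairs that this forbids on a clean
-- walk, so that avoiding them costs at most half of the clean walks to a rich
-- vertex.
module Constants (l s : ℕ) where

  B M Q : ℕ
  B = s + suc l
  M = suc B * suc l
  Q = 2 * M

  1≤M : 1 ≤ M
  1≤M = s≤s z≤n

  M<Q : M < Q
  M<Q = m<m+n M (≤-trans 1≤M (≤-reflexive (sym (+-identityʳ M))))

  1≤Q : 1 ≤ Q
  1≤Q = ≤-trans 1≤M (<⇒≤ M<Q)

  B≤M : B ≤ M
  B≤M = ≤-trans (n≤1+n B) (m≤m*n (suc B) (suc l))

  -- Bounds, in units of `D ^ i`, the walks of length `suc i` that are not super: a bad prefix and a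
  -- bad suffix give `2 * loss i`, coinciding ends give `1`, and rich ends give `Q`.
  loss : ℕ → ℕ
  loss zero    = 0
  loss (suc i) = 2 * loss i + 1 + Q

-- The bound on `D` when no pair of vertices is linked.

module CountingPaths {V : Set} (_≟_ : DecidableEquality V)
                     (vs : List V) (vs-complete : ∀ v → v ∈ vs) (vs-unique : Unique vs)
                     (N : V → List V) (N-unique : ∀ v → Unique (N v))
                     (D : ℕ) (N≤D : ∀ v → length (N v) ≤ D) (l s : ℕ) where

  open Constants l s
  open Walks _≟_ vs vs-complete N N-unique D N≤D Q
  -- Walks follow `N`, but paths may use its edges in both directions, as climbing among last steps
  -- requires.
  open Paths (λ u v → v ∈ N u ⊎ u ∈ N v)

  clean-≢ : ∀ {i x} → Clean i x → ∀ {a b} → a < b → b ≤ suc i → x a ≢ x b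
  clean-≢ (s , s′ , ends) {a} a<b b≤ with ≤-suc-cases b≤
  ... | inj₁ b≤i = super-≢ s a<b b≤i
  clean-≢ (s , s′ , ends) {zero}  a<b b≤ | inj₂ refl = ends
  clean-≢ (s , s′ , ends) {suc a} a<b b≤ | inj₂ refl = super-≢ s′ (≤-pred a<b) ≤-refl

  clean-path : ∀ {i a z x} → Walk (suc i) a x → Clean i x → x (suc i) ≡ z → IsPath (suc i) a z x
  clean-path (x0 , steps) c xz = x0 , xz , (λ j j< → inj₁ (steps j j<)) , clean-≢ c

  -- Each choice of an interior position and a vertex of `U` spoils at most a `1/Q` fraction of the
  -- clean walks. There are at most `M < Q` such choices, so some clean walk avoids `U`.
  rich⇒linked : ∀ {i a z} → i ≤ l → Rich i a z → 1 ≤ #clean i a z → Linked (suc i) B a z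
  rich⇒linked {suc i′} {a} {z} i≤l rich some U U≤B = conclude (1 ≤? ∫ (suc i) a good)
    where
    open ≤-Reasoning
    i = suc i′
    Hit : Seq → Set
    Hit x = Any (λ p → x (suc p) ∈ U) (upTo i)
    hit? : ∀ x → Dec (Hit x)
    hit? x = Any.any? (λ p → Any.any? (x (suc p) ≟_) U) (upTo i)
    good : Seq → ℕ
    good x = ⟦ (clean? i x ×-dec (x (suc i) ≟ z)) ×-dec ¬? (hit? x) ⟧
    via : ℕ → V → Seq → ℕ
    via p u x = ⟦ clean? i x ×-dec (x (suc i) ≟ z) ×-dec (x (suc p) ≟ u) ⟧
    bad : Seq → ℕ
    bad x = ∑ (upTo i) λ p → ∑ U λ u → via p u x
    pointwise : ∀ x → ⟦ clean? i x ×-dec (x (suc i) ≟ z) ⟧ ≤ good x + bad x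
    pointwise x = ⟦⟧-≤ λ (c , e) → cases c e (hit? x)
      where
      cases : Clean i x → x (suc i) ≡ z → Dec (Hit x) → 1 ≤ good x + bad x
      cases c e (no ¬h) = ≤-trans (1≤⟦⟧ ((c , e) , ¬h)) (m≤m+n (good x) (bad x))
      cases c e (yes h) = let p , p∈ , u∈ = find h in begin
        1                            ≤⟨ 1≤⟦⟧ (c , e , refl) ⟩
        via p (x (suc p)) x          ≤⟨ ∑-∈ (λ u → via p u x) u∈ ⟩
        ∑ U (λ u → via p u x)        ≤⟨ ∑-∈ (λ p → ∑ U λ u → via p u x) p∈ ⟩
        bad x                        ≤⟨ m≤n+m (bad x) (good x) ⟩
        good x + bad x               ∎
    few-bad : Q * ∫ (suc i) a bad ≤ M * #clean i a z
    few-bad = begin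
      Q * ∫ (suc i) a bad
        ≡⟨ cong (Q *_) (∫-∑ (suc i) a (upTo i) _) ⟩
      Q * ∑ (upTo i) (λ p → ∫ (suc i) a λ x → ∑ U λ u → via p u x)
        ≡⟨ cong (Q *_) (∑-cong (upTo i) λ p → ∫-∑ (suc i) a U (via p)) ⟩
      Q * ∑ (upTo i) (λ p → ∑ U λ u → #cleanVia i a z (suc p) u)
        ≡⟨ ∑-*ˡ (upTo i) Q _ ⟨
      ∑ (upTo i) (λ p → Q * ∑ U λ u → #cleanVia i a z (suc p) u)
        ≤⟨ ∑-bound (upTo i) (length U * #clean i a z) (λ {p} p∈ →
             ≤-trans (≤-reflexive (sym (∑-*ˡ U Q _)))
                     (∑-bound U (#clean i a z) (λ {u} _ → rich-via rich (∈-upTo⁻ p∈) u))) ⟩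
      length (upTo i) * (length U * #clean i a z)
        ≡⟨ *-assoc (length (upTo i)) (length U) _ ⟨
      length (upTo i) * length U * #clean i a z
        ≤⟨ *-monoˡ-≤ (#clean i a z) (begin
             length (upTo i) * length U  ≡⟨ cong (_* length U) (length-upTo i) ⟩
             i * length U                ≤⟨ *-mono-≤ (m≤n⇒m≤1+n i≤l) (m≤n⇒m≤1+n U≤B) ⟩
             suc l * suc B               ≡⟨ *-comm (suc l) (suc B) ⟩
             M                           ∎) ⟩
      M * #clean i a z ∎
    conclude : Dec (1 ≤ ∫ (suc i) a good) → PathAvoiding (suc i) a z U
    conclude (yes p) =
      let x , w , g = ∫-pos (suc i) a p
          (c , e) , ¬hit = ⟦⟧-pos g
      in x , clean-path w c e , λ { (suc j) _ (s≤s j<i) xj∈ → ¬hit (lose (∈-upTo⁺ j<i) xj∈) }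
    conclude (no ¬p) = contradiction (begin-strict
      M * #clean i a z          <⟨ *-monoˡ-< (#clean i a z) {{>-nonZero some}} M<Q ⟩
      Q * #clean i a z          ≤⟨ *-monoʳ-≤ Q (∫-mono (suc i) a λ x _ → pointwise x) ⟩
      Q * ∫ (suc i) a (λ x → good x + bad x)  ≡⟨ cong (Q *_) (∫-+ (suc i) a good bad) ⟩
      Q * (∫ (suc i) a good + ∫ (suc i) a bad)
        ≡⟨ cong (λ n → Q * (n + ∫ (suc i) a bad)) (n<1⇒n≡0 (≰⇒> ¬p)) ⟩
      Q * ∫ (suc i) a bad       ≤⟨ few-bad ⟩
      M * #clean i a z          ∎) (<-irrefl refl)

  module _ (unlinked : ∀ a b → ¬ Linked (suc l) s a b) where

    -- Here `p` is the number of steps to climb: a clean walk of length `suc i`, continued by `p`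
    -- steps, has length `suc l`.
    module LastSteps (i′ p : ℕ) (p+i≡l : p + suc i′ ≡ l) (a : V) where

      i : ℕ
      i = suc i′

      i≤l : i ≤ l
      i≤l = ≤-trans (m≤n+m i p) (≤-reflexive p+i≡l)

      last? : ∀ w z x → Dec ((Clean i x × Rich i a z) × x i ≡ w × x (suc i) ≡ z)
      last? w z x = (clean? i x ×-dec rich? i a z) ×-dec (x i ≟ w) ×-dec (x (suc i) ≟ z)

      #last : V → V → ℕ
      #last w z = ∫ (suc i) a λ x → ⟦ last? w z x ⟧

      #rich : ℕ
      #rich = ∫ (suc i) a λ x → ⟦ clean? i x ×-dec rich? i a (x (suc i)) ⟧

      #richTo : V → ℕ
      #richTo z = ∫ (suc i) a λ x → ⟦ (clean? i x ×-dec rich? i a z) ×-dec (x (suc i) ≟ z) ⟧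

      #walks : V → ℕ
      #walks w = ∫ i a λ x → ⟦ x i ≟ w ⟧

      steps : List (V × V)
      steps = filter (λ (w , z) → 1 ≤? #last w z) (cartesianProduct vs vs)

      steps-unique : Unique steps
      steps-unique = Unique.filter⁺ _ (Unique.cartesianProduct⁺ vs-unique vs-unique)

      -- Two copies of the vertex set make the graph of last steps bipartite, because a vertex may
      -- be penultimate on one walk and last on another.
      inc : V ⊎ V → V × V → Set
      inc (inj₁ w′) (w , z) = w′ ≡ w
      inc (inj₂ z′) (w , z) = z′ ≡ z

      inc? : ∀ κ e → Dec (inc κ e)
      inc? (inj₁ w′) (w , z) = w′ ≟ w
      inc? (inj₂ z′) (w , z) = z′ ≟ z

      keys : List (V ⊎ V)
      keys = map inj₁ vs ++ map inj₂ vs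

      keys-complete : ∀ κ → κ ∈ keys
      keys-complete (inj₁ w) = ∈-++⁺ˡ (∈-map⁺ inj₁ (vs-complete w))
      keys-complete (inj₂ z) = ∈-++⁺ʳ (map inj₁ vs) (∈-map⁺ inj₂ (vs-complete z))

      open Peeling keys keys-complete inc inc? M

      last-walk : ∀ {w z} → 1 ≤ #last w z →
                  a ≢ w × a ≢ z × z ∈ N w × Rich i a z × 1 ≤ #clean i a z
      last-walk {w} {z} pos =
        let x , (x0 , st) , g = ∫-pos (suc i) a pos
            (c , r) , xw , xz = ⟦⟧-pos g
        in (λ a≡w → clean-≢ c {0} {i} (s≤s z≤n) (n≤1+n i) (trans x0 (trans a≡w (sym xw)))) ,
           (λ a≡z → clean-≢ c {0} {suc i} (s≤s z≤n) ≤-refl (trans x0 (trans a≡z (sym xz)))) ,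
           subst₂ (λ z w → z ∈ N w) xz xw (st i ≤-refl) , r ,
           ≤-trans pos (∫-mono (suc i) a λ x _ → ⟦⟧-≤ λ ((c , _) , _ , e) → 1≤⟦⟧ (c , e))

      module _ (E : List (V × V)) (E⊆ : E ⊆ steps) (E-unique : Unique E) (dense : Dense E) where

        facts : ∀ {w z} → (w , z) ∈ E →
                a ≢ w × a ≢ z × z ∈ N w × Rich i a z × 1 ≤ #clean i a z
        facts e∈ =
          last-walk (proj₂ (∈-filter⁻ (λ (w , z) → 1 ≤? #last w z) {xs = cartesianProduct vs vs} (E⊆ e∈)))

        -- Level 0 consists of the rich ends, which clean walks join to `a`; each further level
        -- changes sides.
        key : ℕ → V → V ⊎ V
        key zero          = inj₂
        key (suc zero)    = inj₁
        key (suc (suc p)) = key p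

        Side : ℕ → V → Set
        Side p y = Any (inc (key p y)) E

        side≢ : ∀ p {y} → Side p y → a ≢ y
        side≢ zero          s = let _ , e∈ , y≡ = find s ; _ , a≢ , _ = facts e∈ in
          λ a≡y → a≢ (trans a≡y y≡)
        side≢ (suc zero)    s = let _ , e∈ , y≡ = find s ; a≢ , _ = facts e∈ in
          λ a≡y → a≢ (trans a≡y y≡)
        side≢ (suc (suc p)) s = side≢ p s

        base : ∀ {y} → Side 0 y → Linked (suc i) B a y
        base s with find s
        ... | _ , e∈ , refl = let _ , _ , _ , r , c = facts e∈ in rich⇒linked i≤l r c

        -- The edges at one vertex have distinct far ends, read off by `f`, and there are more than
        -- `M ≥ B` of them.
        neighbour : ∀ κ (f : V × V → V) →
                    (∀ {e e′} → inc κ e → inc κ e′ → f e ≡ f e′ → e ≡ e′) →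
                    Any (inc κ) E → ∀ U → length U ≤ B →
                    ∃[ e ] e ∈ E × inc κ e × f e ∉ U
        neighbour κ f f-inj s U U≤B =
          let in-filter = λ {e} → ∈-filter⁻ (inc? κ) {v = e} {xs = E}
              c , c∈ , c∉ =
                fresh _≟_ (unique-map f (λ e∈ e′∈ → f-inj (proj₂ (in-filter e∈)) (proj₂ (in-filter e′∈)))
                                       (Unique.filter⁺ (inc? κ) E-unique))
                              U (<-≤-trans (s≤s (≤-trans U≤B B≤M))
                                   (≤-trans (dense κ s) (≤-reflexive (sym (length-map f (filter (inc? κ) E))))))
              e , e∈ , c≡ = ∈-map⁻ f c∈
              e∈E , κe = in-filter e∈
          in e , e∈E , κe , λ fe∈ → c∉ (subst (_∈ U) (sym c≡) fe∈)

        step : ∀ p {y} → Side (suc p) y → ∀ U → length U ≤ B →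
               ∃[ c ] c ∉ U × Side p c × (y ∈ N c ⊎ c ∈ N y)
        step zero {y} s U U≤B with neighbour (inj₁ y) proj₂ (λ { refl refl refl → refl }) s U U≤B
        ... | (_ , c) , e∈ , refl , c∉ =
          let _ , _ , c∈N , _ = facts e∈ in c , c∉ , lose e∈ refl , inj₂ c∈N
        step (suc zero) {y} s U U≤B with neighbour (inj₂ y) proj₁ (λ { refl refl refl → refl }) s U U≤B
        ... | (c , _) , e∈ , refl , c∉ =
          let _ , _ , y∈N , _ = facts e∈ in c , c∉ , lose e∈ refl , inj₁ y∈N
        step (suc (suc p)) s = step p s

        centre : ∀ {e} → e ∈ E → ∀ p → ∃[ y ] Side p y
        centre e∈ zero          = _ , lose e∈ refl
        centre e∈ (suc zero)    = _ , lose e∈ refl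
        centre e∈ (suc (suc p)) = centre e∈ p

        dense⇒linked : ∀ {e} → e ∈ E → ∃[ y ] Linked (suc l) s a y
        dense⇒linked e∈ = let y , side = centre e∈ p in
          y , λ U U≤s → subst (λ k → PathAvoiding k a y U) (trans (+-suc p i) (cong suc p+i≡l))
            (climb Side side≢ base step p side U
              -- At most `s` vertices are given and one more is added at each of the `p ≤ l` levels,
              -- which `B` allows for.
              (+-mono-≤ U≤s (≤-trans (m≤m+n p i) (≤-trans (≤-reflexive p+i≡l) (n≤1+n l)))))

      cost : V ⊎ V → ℕ
      cost (inj₁ w) = Q * #walks w
      cost (inj₂ z) = #richTo z

      -- At `w`: the walk up to `w` and the vertex `z` determine the whole walk. At `z`: the vertex
      -- `w` occupies the last interior position, so richness of the ends limits its share to `1/Q`.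
      #last≤cost : ∀ κ e → inc κ e → Q * #last (proj₁ e) (proj₂ e) ≤ cost κ
      #last≤cost (inj₁ w) (w , z) refl = *-monoʳ-≤ Q (begin
        #last w z
          ≤⟨ ∫-mono (suc i) a (λ x _ → ⟦⟧-≤ λ (_ , e , e′) →
               *-mono-≤ (1≤⟦⟧ {p? = x i ≟ w} e) (1≤⟦⟧ {p? = x (suc i) ≟ z} e′)) ⟩
        ∫ (suc i) a (λ x → ⟦ x i ≟ w ⟧ * ⟦ x (suc i) ≟ z ⟧)
          ≤⟨ ∫-last i a {h = λ v → ⟦ v ≟ z ⟧} (local-at i w) (λ y → ∑-≟ _≟_ z (N-unique y)) ⟩
        #walks w * 1
          ≡⟨ *-identityʳ _ ⟩
        #walks w ∎)
        where open ≤-Reasoning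
      #last≤cost (inj₂ z) (w , z) refl = branch (rich? i a z)
        where
        open ≤-Reasoning
        branch : Dec (Rich i a z) → Q * #last w z ≤ #richTo z
        branch (yes r) = begin
          Q * #last w z
            ≤⟨ *-monoʳ-≤ Q (∫-mono (suc i) a λ x _ → ⟦⟧-≤ λ ((c , _) , e , e′) → 1≤⟦⟧ (c , e′ , e)) ⟩
          Q * #cleanVia i a z i w ≤⟨ rich-via r ≤-refl w ⟩
          #clean i a z           ≤⟨ ∫-mono (suc i) a (λ x _ → ⟦⟧-≤ λ (c , e) → 1≤⟦⟧ ((c , r) , e)) ⟩
          #richTo z              ∎
        branch (no ¬r) = begin
          Q * #last w z
            ≤⟨ *-monoʳ-≤ Q (∫-mono (suc i) a λ x _ → ⟦⟧-≤ λ ((_ , r) , _) → contradiction r ¬r) ⟩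
          Q * ∫ (suc i) a (λ _ → 0 * 0) ≡⟨ cong (Q *_) (∫-*ˡ (suc i) a 0 (const 0)) ⟩
          Q * 0                  ≡⟨ *-zeroʳ Q ⟩
          0                      ≤⟨ z≤n ⟩
          #richTo z              ∎

      #rich≤#last : #rich ≤ ∑ steps (λ (w , z) → #last w z)
      #rich≤#last = begin
        #rich
          ≤⟨ ∫-mono (suc i) a (λ x _ → ⟦⟧-≤ λ (c , r) →
               ≤-trans (1≤⟦⟧ ((c , r) , refl , refl))
                 (∑-∈ (λ (w , z) → ⟦ last? w z x ⟧)
                   (∈-cartesianProduct⁺ (vs-complete (x i)) (vs-complete (x (suc i)))))) ⟩
        ∫ (suc i) a (λ x → ∑ pairs λ (w , z) → ⟦ last? w z x ⟧)
          ≡⟨ ∫-∑ (suc i) a pairs (λ (w , z) x → ⟦ last? w z x ⟧) ⟩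
        ∑ pairs count
          ≡⟨ ∑-filter pos? pairs count ⟩
        ∑ steps count + ∑ (filter (∁? pos?) pairs) count
          ≤⟨ +-monoʳ-≤ (∑ steps count) (∑-bound (filter (∁? pos?) pairs) 0 (λ e∈ →
               ≤-pred (≰⇒> (proj₂ (∈-filter⁻ (∁? pos?) {xs = pairs} e∈))))) ⟩
        ∑ steps count + length (filter (∁? pos?) pairs) * 0
          ≡⟨ cong (∑ steps count +_) (*-zeroʳ (length (filter (∁? pos?) pairs))) ⟩
        ∑ steps count + 0
          ≡⟨ +-identityʳ _ ⟩
        ∑ steps count ∎
        where
        open ≤-Reasoning
        pairs = cartesianProduct vs vs
        count : V × V → ℕ
        count (w , z) = #last w z
        pos? : ∀ e → Dec (1 ≤ count e)
        pos? (w , z) = 1 ≤? #last w z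

      ∑-#walks : ∑ vs #walks ≤ D ^ i
      ∑-#walks = begin
        ∑ vs #walks                              ≡⟨ ∫-∑ i a vs (λ w x → ⟦ x i ≟ w ⟧) ⟨
        ∫ i a (λ x → ∑ vs λ w → ⟦ x i ≟ w ⟧)
          ≤⟨ ∫-mono i a (λ x _ → ≤-trans
               (∑-mono vs λ {w} _ → ⟦⟧-≤ {p? = x i ≟ w} (1≤⟦⟧ ∘ sym)) (∑-≟ _≟_ (x i) vs-unique)) ⟩
        ∫ i a (const 1)                          ≤⟨ ∫-1≤ i a ⟩
        D ^ i                                    ∎
        where open ≤-Reasoning

      ∑-#richTo : ∑ vs #richTo ≤ #rich
      ∑-#richTo = begin
        ∑ vs #richTo
          ≡⟨ ∫-∑ (suc i) a vs (λ z x → ⟦ (clean? i x ×-dec rich? i a z) ×-dec (x (suc i) ≟ z) ⟧) ⟨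
        ∫ (suc i) a (λ x → ∑ vs λ z → ⟦ (clean? i x ×-dec rich? i a z) ×-dec (x (suc i) ≟ z) ⟧)
          ≤⟨ ∫-mono (suc i) a (λ x _ → single x) ⟩
        #rich ∎
        where
        open ≤-Reasoning
        single : ∀ x → ∑ vs (λ z → ⟦ (clean? i x ×-dec rich? i a z) ×-dec (x (suc i) ≟ z) ⟧) ≤
                       ⟦ clean? i x ×-dec rich? i a (x (suc i)) ⟧
        single x = begin
          ∑ vs (λ z → ⟦ (clean? i x ×-dec rich? i a z) ×-dec (x (suc i) ≟ z) ⟧)
            ≤⟨ ∑-mono vs (λ {z} _ → ⟦⟧-≤ λ ((c , r) , e) →
                 *-mono-≤ (1≤⟦⟧ {p? = clean? i x ×-dec rich? i a (x (suc i))} (c , subst (Rich i a) (sym e) r))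
                          (1≤⟦⟧ {p? = z ≟ x (suc i)} (sym e))) ⟩
          ∑ vs (λ z → ⟦ clean? i x ×-dec rich? i a (x (suc i)) ⟧ * ⟦ z ≟ x (suc i) ⟧)
            ≡⟨ ∑-*ˡ vs ⟦ clean? i x ×-dec rich? i a (x (suc i)) ⟧ _ ⟩
          ⟦ clean? i x ×-dec rich? i a (x (suc i)) ⟧ * ∑ vs (λ z → ⟦ z ≟ x (suc i) ⟧)
            ≤⟨ *-monoʳ-≤ ⟦ clean? i x ×-dec rich? i a (x (suc i)) ⟧ (∑-≟ _≟_ (x (suc i)) vs-unique) ⟩
          ⟦ clean? i x ×-dec rich? i a (x (suc i)) ⟧ * 1
            ≡⟨ *-identityʳ _ ⟩
          ⟦ clean? i x ×-dec rich? i a (x (suc i)) ⟧ ∎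

      -- No key is peeled twice, so the costs add up to `Q * #rich ≤ M * (Q * D ^ i + #rich)`. As
      -- `Q` is `2 * M`, half of the left side absorbs the last term.
      peeled⇒few-rich : ∀ {κs} → Peeled κs steps → #rich ≤ Q * D ^ i
      peeled⇒few-rich {κs} peeled =
        +-cancelʳ-≤ #rich #rich (Q * D ^ i) (*-cancelˡ-≤ M {{>-nonZero 1≤M}} (begin
        M * (#rich + #rich)
          ≡⟨ lemma M #rich ⟩
        Q * #rich
          ≤⟨ *-monoʳ-≤ Q #rich≤#last ⟩
        Q * ∑ steps (λ (w , z) → #last w z)
          ≡⟨ ∑-*ˡ steps Q _ ⟨
        ∑ steps (λ (w , z) → Q * #last w z)
          ≤⟨ peeled-∑ (λ (w , z) → Q * #last w z) cost #last≤cost peeled ⟩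
        M * ∑ κs cost
          ≤⟨ *-monoʳ-≤ M (∑-⊆ cost (peeled-unique peeled) (λ {κ} _ → keys-complete κ)) ⟩
        M * ∑ keys cost
          ≡⟨ cong (M *_) (trans (∑-++ (map inj₁ vs) (map inj₂ vs) cost)
               (cong₂ _+_ (trans (∑-map inj₁ vs cost) (∑-*ˡ vs Q #walks)) (∑-map inj₂ vs cost))) ⟩
        M * (Q * ∑ vs #walks + ∑ vs #richTo)
          ≤⟨ *-monoʳ-≤ M (+-mono-≤ (*-monoʳ-≤ Q ∑-#walks) ∑-#richTo) ⟩
        M * (Q * D ^ i + #rich) ∎))
        where
        open ≤-Reasoning
        lemma : ∀ M r → M * (r + r) ≡ 2 * M * r
        lemma = solve-∀

      few-rich′ : #rich ≤ Q * D ^ i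
      few-rich′ = branch (peeling steps steps-unique)
        where
        branch : (∃[ E ] E ≢ [] × E ⊆ steps × Unique E × Dense E) ⊎ ∃[ κs ] Peeled κs steps →
                 #rich ≤ Q * D ^ i
        branch (inj₂ (_ , peeled)) = peeled⇒few-rich peeled
        branch (inj₁ ([] , E≢[] , _)) = contradiction refl E≢[]
        branch (inj₁ (E@(_ ∷ _) , _ , E⊆ , E-unique , dense)) =
          let y , linked = dense⇒linked E E⊆ E-unique dense (here refl) in
          contradiction linked (unlinked a y)

    few-rich : ∀ i → i ≤ l → ∀ a →
               ∫ (suc i) a (λ x → ⟦ clean? i x ×-dec rich? i a (x (suc i)) ⟧) ≤ Q * D ^ i
    few-rich zero     _   a =
      ≤-trans (∫-mono 1 a λ x _ → ⟦⟧-≤ {n = 0 * 0} λ ()) (≤-trans (≤-reflexive (∫-*ˡ 1 a 0 (const 0))) z≤n)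
    few-rich (suc i′) i≤l a = let p , i+p≡l = m≤n⇒∃[o]m+o≡n i≤l in
      LastSteps.few-rich′ i′ p (trans (+-comm p (suc i′)) i+p≡l) a

    -- Defined by cases because the exponent of `D` is one less than the length of the walk.
    lossBound : ℕ → ℕ
    lossBound zero    = 0
    lossBound (suc i) = loss (suc i) * D ^ i

    D*lossBound : ∀ i → D * lossBound i ≡ loss i * D ^ i
    D*lossBound zero    = *-zeroʳ D
    D*lossBound (suc i) = lemma D (loss (suc i)) (D ^ i)
      where
      lemma : ∀ a b c → a * (b * c) ≡ b * (a * c)
      lemma = solve-∀

    -- A walk that is not super has a prefix or suffix that is not, returns to its start, or is
    -- clean with rich ends. A bad prefix or suffix extends by one step in at most `D` ways.
    few-unsuper : ∀ i → i ≤ suc l → ∀ a → ∫ i a (λ x → ⟦ ¬? (super? i x) ⟧) ≤ lossBound i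
    few-unsuper zero    _   a = ≤-trans (∫-mono 0 a {g = λ _ → 0 * 0} λ _ _ → z≤n)
                                        (≤-reflexive (∫-*ˡ 0 a 0 (const 0)))
    few-unsuper (suc i) i<k a = begin
      ∫ (suc i) a (λ x → ⟦ ¬? (super? (suc i) x) ⟧)
        ≤⟨ ∫-mono (suc i) a (λ x (x0 , _) → ⟦⟧-≤ (pointwise x x0)) ⟩
      ∫ (suc i) a (λ x → prefix x + (suffix x + (closed x + rich x)))
        ≡⟨ trans (∫-+ (suc i) a prefix _) (cong (∫ (suc i) a prefix +_)
             (trans (∫-+ (suc i) a suffix _) (cong (∫ (suc i) a suffix +_) (∫-+ (suc i) a closed rich)))) ⟩
      ∫ (suc i) a prefix + (∫ (suc i) a suffix + (∫ (suc i) a closed + ∫ (suc i) a rich))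
        ≤⟨ +-mono-≤ few-prefix (+-mono-≤ few-suffix (+-mono-≤ few-closed (few-rich i (≤-pred i<k) a))) ⟩
      loss i * D ^ i + (loss i * D ^ i + (D ^ i + Q * D ^ i))
        ≡⟨ lemma (loss i) (D ^ i) Q ⟩
      (2 * loss i + 1 + Q) * D ^ i ∎
      where
      open ≤-Reasoning
      lemma : ∀ c d q → c * d + (c * d + (d + q * d)) ≡ (2 * c + 1 + q) * d
      lemma = solve-∀
      prefix suffix closed rich : Seq → ℕ
      prefix x = ⟦ ¬? (super? i x) ⟧
      suffix x = ⟦ ¬? (super? i (x ∘ suc)) ⟧
      closed x = ⟦ x (suc i) ≟ a ⟧
      rich   x = ⟦ clean? i x ×-dec rich? i a (x (suc i)) ⟧
      unsuper : ∀ y → ∫ i y prefix ≤ lossBound i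
      unsuper = few-unsuper i (≤-trans (n≤1+n i) i<k)
      few-prefix : ∫ (suc i) a prefix ≤ loss i * D ^ i
      few-prefix = begin
        ∫ (suc i) a prefix
          ≤⟨ ∫-mono (suc i) a (λ x _ → ≤-reflexive (sym (*-identityʳ (prefix x)))) ⟩
        ∫ (suc i) a (λ x → prefix x * 1)
          ≤⟨ ∫-last i a {prefix} {const 1} local-prefix (λ y →
               ≤-trans (≤-reflexive (sym (length-∑ (N y)))) (N≤D y)) ⟩
        ∫ i a prefix * D                  ≤⟨ *-monoˡ-≤ D (unsuper a) ⟩
        lossBound i * D                   ≡⟨ trans (*-comm (lossBound i) D) (D*lossBound i) ⟩
        loss i * D ^ i                    ∎
        where
        local-prefix : Local i prefix
        local-prefix x y x≈y = ⟦⟧-cong (_∘ super-cong i (agree-sym x≈y)) (_∘ super-cong i x≈y)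
      few-suffix : ∫ (suc i) a suffix ≤ loss i * D ^ i
      few-suffix = begin
        ∫ (suc i) a suffix
          ≤⟨ ∫-mono (suc i) a (λ x _ → ≤-reflexive (sym (*-identityˡ (suffix x)))) ⟩
        ∫ (suc i) a (λ x → 1 * suffix x)
          ≤⟨ ∫-split 1 a {const 1} {prefix} (λ _ _ _ → refl) unsuper ⟩
        ∫ 1 a (const 1) * lossBound i     ≤⟨ *-monoˡ-≤ (lossBound i) (∫-1≤ 1 a) ⟩
        D * 1 * lossBound i               ≡⟨ cong (_* lossBound i) (*-identityʳ D) ⟩
        D * lossBound i                   ≡⟨ D*lossBound i ⟩
        loss i * D ^ i                    ∎
      few-closed : ∫ (suc i) a closed ≤ D ^ i
      few-closed = begin
        ∫ (suc i) a closed
          ≤⟨ ∫-mono (suc i) a (λ x _ → ≤-reflexive (sym (*-identityˡ (closed x)))) ⟩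
        ∫ (suc i) a (λ x → 1 * closed x)
          ≤⟨ ∫-last i a {const 1} {λ v → ⟦ v ≟ a ⟧} (λ _ _ _ → refl) (λ y → ∑-≟ _≟_ a (N-unique y)) ⟩
        ∫ i a (const 1) * 1               ≡⟨ *-identityʳ _ ⟩
        ∫ i a (const 1)                   ≤⟨ ∫-1≤ i a ⟩
        D ^ i                             ∎
      pointwise : ∀ x → x 0 ≡ a → ¬ Super (suc i) x → 1 ≤ prefix x + (suffix x + (closed x + rich x))
      pointwise x x0 ¬s =
        cases (super? i x) (super? i (x ∘ suc)) (x (suc i) ≟ a) (rich? i a (x (suc i)))
        where
        rest₂ = closed x + rich x
        rest₁ = suffix x + rest₂
        cases : Dec (Super i x) → Dec (Super i (x ∘ suc)) → Dec (x (suc i) ≡ a) → Dec (Rich i a (x (suc i))) →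
                1 ≤ prefix x + rest₁
        cases (no ¬p) _ _ _ = ≤-trans (1≤⟦⟧ ¬p) (m≤m+n (prefix x) rest₁)
        cases _ (no ¬p) _ _ =
          ≤-trans (1≤⟦⟧ ¬p) (≤-trans (m≤m+n (suffix x) rest₂) (m≤n+m rest₁ (prefix x)))
        cases _ _ (yes p) _ = ≤-trans (1≤⟦⟧ p) (≤-trans (m≤m+n (closed x) (rich x))
          (≤-trans (m≤n+m rest₂ (suffix x)) (m≤n+m rest₁ (prefix x))))
        cases (yes s) (yes s′) (no ¬c) (yes r) =
          ≤-trans (1≤⟦⟧ ((s , s′ , λ e → ¬c (trans (sym e) x0)) , r)) (≤-trans (m≤n+m (rich x) (closed x))
            (≤-trans (m≤n+m rest₂ (suffix x)) (m≤n+m rest₁ (prefix x))))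
        cases (yes s) (yes s′) (no ¬c) (no ¬r) =
          contradiction ((s , s′ , λ e → ¬c (trans (sym e) x0)) ,
                         λ r → ¬r (subst (λ v → Rich i v (x (suc i))) x0 r)) ¬s

    -- Super walks are sorted by their end vertex, with at most `Q ^ l` for each; the other walks
    -- are counted by `few-unsuper`.
    walk-bound : (∀ {u v} → u ∈ N v → length (N u) ≡ D) → ∀ {a} → length (N a) ≡ D →
                 D ^ suc l ≤ length vs * Q ^ l + loss (suc l) * D ^ l
    walk-bound regular {a} len = begin
      D ^ k
        ≤⟨ ∫-≥1 regular k len ⟩
      ∫ k a (const 1)
        ≤⟨ ∫-mono k a (λ x _ → split x (super? k x)) ⟩
      ∫ k a (λ x → ∑ vs (λ z → superTo z x) + ⟦ ¬? (super? k x) ⟧)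
        ≡⟨ ∫-+ k a _ _ ⟩
      ∫ k a (λ x → ∑ vs (λ z → superTo z x)) + ∫ k a (λ x → ⟦ ¬? (super? k x) ⟧)
        ≤⟨ +-mono-≤ (≤-trans (≤-reflexive (∫-∑ k a vs superTo))
                             (∑-bound vs (Q ^ l) λ {z} _ → super-count 1≤Q l a z))
                    (few-unsuper k ≤-refl a) ⟩
      length vs * Q ^ l + loss k * D ^ l ∎
      where
      open ≤-Reasoning
      k = suc l
      superTo : V → Seq → ℕ
      superTo z x = ⟦ super? k x ×-dec (x k ≟ z) ⟧
      split : ∀ x → Dec (Super k x) → 1 ≤ ∑ vs (λ z → superTo z x) + ⟦ ¬? (super? k x) ⟧
      split x (yes s) =
        ≤-trans (≤-trans (1≤⟦⟧ (s , refl)) (∑-∈ (λ z → superTo z x) (vs-complete (x k))))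
        (m≤m+n (∑ vs (λ z → superTo z x)) ⟦ ¬? (super? k x) ⟧)
      split x (no ¬s) = ≤-trans (1≤⟦⟧ ¬s) (m≤n+m _ (∑ vs (λ z → superTo z x)))

-- Berge copies from distinct hyperedges, and distinct representatives.

lookup-injective : ∀ {A : Set} {xs : List A} → Unique xs → ∀ {i j} → lookup xs i ≡ lookup xs j → i ≡ j
lookup-injective (x∉ ∷ u) {zero}  {zero}  eq = refl
lookup-injective (x∉ ∷ u) {zero}  {suc j} eq = contradiction eq (All.lookup x∉ (∈-lookup j))
lookup-injective (x∉ ∷ u) {suc i} {zero}  eq = contradiction (sym eq) (All.lookup x∉ (∈-lookup i))
lookup-injective (x∉ ∷ u) {suc i} {suc j} eq = cong suc (lookup-injective u eq)

map-injective : ∀ {A B : Set} {f : A → B} {xs} → Unique (map f xs) →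
                ∀ {x y} → x ∈ xs → y ∈ xs → f x ≡ f y → x ≡ y
map-injective         _        (here refl) (here refl) eq = refl
map-injective {f = f} (x∉ ∷ u) (here refl) (there y∈)  eq = contradiction eq (All.lookup x∉ (∈-map⁺ f y∈))
map-injective {f = f} (x∉ ∷ u) (there x∈)  (here refl) eq = contradiction (sym eq) (All.lookup x∉ (∈-map⁺ f x∈))
map-injective         (_ ∷ u)  (there x∈)  (there y∈)  eq = map-injective u x∈ y∈ eq

∈-image⁺ : ∀ {m n} (f : Fin m → Fin n) {p i} → i ∈ˢ p → f i ∈ˢ image f p
∈-image⁺ f {p} {i} i∈p = Vec.lookup⇒[]= (f i) (image f p)
  (trans (Vec.lookup∘tabulate _ (f i))
         (dec-true (Fin.any? λ i′ → (i′ ∈? p) ×-dec (f i′ Fin.≟ f i)) (i , i∈p , refl)))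

∈-image⁻ : ∀ {m n} (f : Fin m → Fin n) {p j} → j ∈ˢ image f p → ∃[ i ] i ∈ˢ p × f i ≡ j
∈-image⁻ f {p} {j} j∈ = witness (Fin.any? λ i → (i ∈? p) ×-dec (f i Fin.≟ j))
  (trans (sym (Vec.lookup∘tabulate _ j)) (Vec.[]=⇒lookup j∈))
  where
  witness : ∀ {P : Set} (p? : Dec P) → does p? ≡ true → P
  witness (yes p) _ = p

image-id : ∀ {n} (p : Subset n) → image id p ≡ p
image-id p = ⊆-antisym (λ j∈ → let i , i∈ , i≡j = ∈-image⁻ id j∈ in subst (_∈ˢ p) i≡j i∈)
                       (∈-image⁺ id)

module _ {v r n : ℕ} (F : Graph v) (H : Hypergraph r n)
         (ι : Fin v → Fin n) (ι-injective : Injective _≡_ _≡_ ι)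
         (g : Edge F → Subset n) (g-injective : Injective _≡_ _≡_ g)
         (g∈H : ∀ e → g e ∈ edges H) (ι⊆g : ∀ e {u} → u ∈ˢ ends F e → ι u ∈ˢ g e) where

  private
    -- A Berge copy needs a bijection of edges, so the copy is made of the chosen hyperedges alone,
    -- on the whole vertex set of `H`.
    G : Hypergraph r n
    G = record
      { edges   = tabulate g
      ; simple  = Unique.tabulate⁺ g-injective
      ; uniform = All.tabulate⁺ λ e → All.lookup (Hypergraph.uniform H) (g∈H e)
      }

    to : Edge F → Edge G
    to = cast (sym (length-tabulate g))

    to-injective : Injective _≡_ _≡_ to
    to-injective {e} {e′} eq = Fin.toℕ-injective
      (trans (sym (Fin.toℕ-cast _ e)) (trans (cong toℕ eq) (Fin.toℕ-cast _ e′)))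

    ends-to : ∀ e → ends G (to e) ≡ g e
    ends-to = lookup-tabulate g

  berge-copy : ¬ (H IsFree-of Berge F r)
  berge-copy free =
    free G berge (mk↣ id , All.tabulate⁺ λ e → subst (_∈ edges H) (sym (image-id (g e))) (g∈H e))
    where
    berge : Berge F r G
    berge = mk↣ ι-injective ,
            mk⤖ (to-injective , λ e → cast (length-tabulate g) e , λ { refl →
                   trans (Fin.cast-trans (length-tabulate g) (sym (length-tabulate g)) e)
                         (Fin.cast-is-id refl e) }) ,
            λ e j∈ → let i , i∈ , ιi≡j = ∈-image⁻ ι j∈ in
              subst₂ _∈ˢ_ ιi≡j (sym (ends-to e)) (ι⊆g e i∈)

-- Greedy choice: every list is longer than the number of elements already taken, and these are
-- collected in `used`.
representatives : ∀ {A : Set} (_≟_ : DecidableEquality A) m (choices : Fin m → List A) →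
                  (∀ i → Unique (choices i)) → (used : List A) →
                  (∀ i → length used + m ≤ length (choices i)) →
                  ∃[ g ] Injective _≡_ _≡_ g × (∀ i → g i ∈ choices i) × (∀ i → g i ∉ used)
representatives _≟_ zero    choices unique used enough = (λ ()) , (λ { {()} }) , (λ ()) , λ ()
representatives _≟_ (suc m) choices unique used enough =
  let c , c∈ , c∉ = fresh _≟_ (unique zero) used (≤-trans (m<m+n (length used) (s≤s z≤n)) (enough zero))
      g , g-inj , g∈ , g∉ = representatives _≟_ m (choices ∘ suc) (unique ∘ suc) (c ∷ used)
                              (λ i → ≤-trans (≤-reflexive (sym (+-suc (length used) m))) (enough (suc i)))
  in (λ { zero → c ; (suc i) → g i }) ,
     (λ { {zero}  {zero}  eq → refl
        ; {zero}  {suc j} eq → contradiction (here (sym eq)) (g∉ j)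
        ; {suc i} {zero}  eq → contradiction (here eq) (g∉ i)
        ; {suc i} {suc j} eq → cong suc (g-inj eq) }) ,
     (λ { zero → c∈ ; (suc i) → g∈ i }) ,
     (λ { zero → c∉ ; (suc i) → g∉ i ∘ there })

-- Counting hyperedges inside a vertex set, and vertices of hyperedges.

bitVectors : ∀ s → List (Vec Bool s)
bitVectors zero    = [] ∷ []
bitVectors (suc s) = map (true ∷_) (bitVectors s) ++ map (false ∷_) (bitVectors s)

length-bitVectors : ∀ s → length (bitVectors s) ≡ 2 ^ s
length-bitVectors zero    = refl
length-bitVectors (suc s) = trans (length-++ (map (true ∷_) (bitVectors s)))
  (cong₂ _+_ (trans (length-map (true ∷_) (bitVectors s)) (length-bitVectors s))
             (trans (trans (length-map (false ∷_) (bitVectors s)) (length-bitVectors s))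
                    (sym (+-identityʳ (2 ^ s)))))

bitVectors-complete : ∀ {s} (v : Vec Bool s) → v ∈ bitVectors s
bitVectors-complete []          = here refl
bitVectors-complete (true ∷ v)  = ∈-++⁺ˡ (∈-map⁺ (true ∷_) (bitVectors-complete v))
bitVectors-complete (false ∷ v) =
  ∈-++⁺ʳ (map (true ∷_) _) (∈-map⁺ (false ∷_) (bitVectors-complete v))

module _ {n : ℕ} (U : List (Fin n)) where

  Within : Subset n → Set
  Within e = ∀ {x} → x ∈ˢ e → x ∈ U

  trace : Subset n → Vec Bool (length U)
  trace e = Vec.map (Vec.lookup e) (Vec.fromList U)

  trace-⊆ : ∀ {e e′} → Within e → trace e ≡ trace e′ → e ⊆ˢ e′
  trace-⊆ {e} {e′} w eq {x} x∈ =
    Vec.lookup⇒[]= x e′ (trans (sym (agree U eq (w x∈))) (Vec.[]=⇒lookup x∈))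
    where
    agree : ∀ xs → Vec.map (Vec.lookup e) (Vec.fromList xs) ≡ Vec.map (Vec.lookup e′) (Vec.fromList xs) →
            x ∈ xs → Vec.lookup e x ≡ Vec.lookup e′ x
    agree (_ ∷ xs) eq (here refl) = Vec.∷-injectiveˡ eq
    agree (_ ∷ xs) eq (there x∈)  = agree xs (Vec.∷-injectiveʳ eq) x∈

  -- A set within `U` is determined by its `trace`, a bit vector of length `length U`.
  within-bound : ∀ {es} → Unique es → (∀ {e} → e ∈ es → Within e) → length es ≤ 2 ^ length U
  within-bound {es} unique within = begin
    length es                          ≡⟨ length-map trace es ⟨
    length (map trace es)
      ≤⟨ length-⊆ (unique-map trace trace-injective unique) (λ _ → bitVectors-complete _) ⟩
    length (bitVectors (length U))     ≡⟨ length-bitVectors (length U) ⟩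
    2 ^ length U                       ∎
    where
    open ≤-Reasoning
    trace-injective : ∀ {e e′} → e ∈ es → e′ ∈ es → trace e ≡ trace e′ → e ≡ e′
    trace-injective e∈ e′∈ eq =
      ⊆-antisym (trace-⊆ (within e∈) eq) (trace-⊆ (within e′∈) (sym eq))

  escape : ∀ {es} → Unique es → 2 ^ length U < length es → ∃[ e ] e ∈ es × ∃[ x ] x ∈ˢ e × x ∉ U
  escape {es} unique many
    with Any.any? (λ e → Fin.any? λ x → (x ∈? e) ×-dec ¬? (Any.any? (x Fin.≟_) U)) es
  ... | yes p = let e , e∈ , x , x∈ , x∉ = find p in e , e∈ , x , x∈ , x∉
  ... | no ¬p = contradiction (within-bound unique within) (<⇒≱ many)
    where
    within : ∀ {e} → e ∈ es → Within e
    within e∈ {x} x∈ with Any.any? (x Fin.≟_) U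
    ... | yes x∈U = x∈U
    ... | no  x∉U = contradiction (lose e∈ (x , x∈ , x∉U)) ¬p

1≤∣p∣⇒∃ : ∀ {n} (p : Subset n) → 1 ≤ ∣ p ∣ → ∃[ x ] x ∈ˢ p
1≤∣p∣⇒∃ (inside  ∷ p) _ = zero , Vec.here
1≤∣p∣⇒∃ (outside ∷ p) h = let x , x∈ = 1≤∣p∣⇒∃ p h in suc x , Vec.there x∈

2≤∣p∣⇒∃₂ : ∀ {n} (p : Subset n) → 2 ≤ ∣ p ∣ → ∃₂ λ x y → x ≢ y × x ∈ˢ p × y ∈ˢ p
2≤∣p∣⇒∃₂ (inside  ∷ p) (s≤s h) =
  let y , y∈ = 1≤∣p∣⇒∃ p h in zero , suc y , (λ ()) , Vec.here , Vec.there y∈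
2≤∣p∣⇒∃₂ (outside ∷ p) h = let x , y , x≢y , x∈ , y∈ = 2≤∣p∣⇒∃₂ p h in
  suc x , suc y , x≢y ∘ Fin.suc-injective , Vec.there x∈ , Vec.there y∈

-- An edge can have several such descriptions, as all paths coincide for `l = 0`; one of them is
-- fixed here.
theta-edge : ∀ l t (e : Edge (Θ (suc l) t)) → ∃₂ λ i j →
             ends (Θ (suc l) t) e ≡ ⁅ Theta.path l t i (inject₁ j) ⁆ ∪ ⁅ Theta.path l t i (suc j) ⁆
theta-edge l t e =
  let i , j , _ , _ , eq = ∈-cartesianProductWith⁻ (Theta.edge l t) (allFin t) (allFin (suc l))
        (∈-deduplicate⁻ _≟ˢ_ (cartesianProductWith (Theta.edge l t) (allFin t) (allFin (suc l)))
          (∈-lookup {xs = edges (Θ (suc l) t)} e))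
  in i , j , eq

∈-take⁻ : ∀ {A : Set} m {xs : List A} {x} → x ∈ take m xs → x ∈ xs
∈-take⁻ (suc m) {_ ∷ _} (here refl) = here refl
∈-take⁻ (suc m) {_ ∷ _} (there x∈)  = there (∈-take⁻ m x∈)

-- Pairs of vertices lying in more than this many hyperedges can be joined
-- greedily: among 2 ^ (2 + m) + 1 hyperedges one leaves any given set of
-- 2 + m vertices, and the second summand leaves room for choosing distinct
-- hyperedges for all edges of the theta graph.
codegreeCap : ℕ → ℕ → ℕ
codegreeCap l t = 2 ^ (2 + (t * l + l)) + size (Θ (suc l) t)

-- Hyperedges labelled by distinct pairs of vertices.

module BergeTheta {r n : ℕ} (2≤r : 2 ≤ r) (l t : ℕ) (H : Hypergraph r n)
                  (free : H IsFree-of Berge (Θ (suc l) t) r) where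

  V : Set
  V = Fin n

  F : Graph (2 + t * l)
  F = Θ (suc l) t

  s : ℕ
  s = t * l

  open Constants l s using (Q; loss)

  cap : ℕ
  cap = codegreeCap l t

  -- The order makes each unordered pair of distinct vertices a single key.
  Contains : V × V → Subset n → Set
  Contains (u , v) e = toℕ u < toℕ v × u ∈ˢ e × v ∈ˢ e

  contains? : ∀ κ e → Dec (Contains κ e)
  contains? (u , v) e = toℕ u <? toℕ v ×-dec (u ∈? e) ×-dec (v ∈? e)

  pairs : List (V × V)
  pairs = cartesianProduct (allFin n) (allFin n)

  pairs-complete : ∀ κ → κ ∈ pairs
  pairs-complete (u , v) = ∈-cartesianProduct⁺ (∈-allFin u) (∈-allFin v)

  open Peeling pairs pairs-complete Contains contains? cap

  module _ (E : List (Subset n)) (E⊆H : E ⊆ edges H) (E-unique : Unique E) (dense : Dense E) where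

    both? : (u v : V) (e : Subset n) → Dec (u ∈ˢ e × v ∈ˢ e)
    both? u v e = (u ∈? e) ×-dec (v ∈? e)

    common : V → V → List (Subset n)
    common u v = filter (both? u v) E

    common-unique : ∀ u v → Unique (common u v)
    common-unique u v = Unique.filter⁺ (both? u v) E-unique

    open Paths (λ u v → cap < length (common u v))

    heavy : ∀ {u v e} → u ≢ v → e ∈ E → u ∈ˢ e → v ∈ˢ e → cap < length (common u v)
    heavy {u} {v} {e} u≢v e∈ u∈ v∈ = cases (<-cmp (toℕ u) (toℕ v))
      where
      cases : Tri (toℕ u < toℕ v) (toℕ u ≡ toℕ v) (toℕ v < toℕ u) → cap < length (common u v)
      cases (tri≈ _ u≡v _) = contradiction (Fin.toℕ-injective u≡v) u≢v
      cases (tri< u<v _ _) = <-≤-trans (dense (u , v) (lose e∈ (u<v , u∈ , v∈)))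
        (length-⊆ (Unique.filter⁺ (contains? (u , v)) E-unique) λ f∈ →
          let f∈E , _ , u∈f , v∈f = ∈-filter⁻ (contains? (u , v)) {xs = E} f∈
          in ∈-filter⁺ (both? u v) f∈E (u∈f , v∈f))
      cases (tri> _ _ v<u) = <-≤-trans (dense (v , u) (lose e∈ (v<u , v∈ , u∈)))
        (length-⊆ (Unique.filter⁺ (contains? (v , u)) E-unique) λ f∈ →
          let f∈E , _ , v∈f , u∈f = ∈-filter⁻ (contains? (v , u)) {xs = E} f∈
          in ∈-filter⁺ (both? u v) f∈E (u∈f , v∈f))

    Side : V → V → Set
    Side a y = a ≢ y × ∃[ e ] e ∈ E × a ∈ˢ e × y ∈ˢ e

    base : ∀ {a y} → Side a y → Linked 1 (s + l) a y
    base {a} {y} (a≢y , e , e∈ , a∈ , y∈) U _ =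
      x , (refl , refl , (λ { zero _ → heavy a≢y e∈ a∈ y∈ ; (suc _) (s≤s ()) }) , distinct) ,
      λ { zero () _ ; (suc _) _ (s≤s ()) }
      where
      x : ℕ → V
      x zero    = a
      x (suc _) = y
      distinct : ∀ {i j} → i < j → j ≤ 1 → x i ≢ x j
      distinct {zero}  {suc zero} _ _ = a≢y
      distinct {suc _} {suc zero} (s≤s ()) _
      distinct {_} {suc (suc _)} _ (s≤s ())

    -- Among the many hyperedges through `a` and `y`, one leaves `a ∷ y ∷ U` at some `c`. Containing
    -- `a`, it keeps `c` in `Side a`; containing `y`, it makes `c` and `y` adjacent.
    step : ∀ {a y} → Side a y → ∀ U → length U ≤ s + l →
           ∃[ c ] c ∉ U × Side a c × cap < length (common c y)
    step {a} {y} (a≢y , e , e∈ , a∈ , y∈) U U≤B =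
      let f , f∈ , c , c∈f , c∉ = escape (a ∷ y ∷ U) (common-unique a y) many
          f∈E , a∈f , y∈f = ∈-filter⁻ (both? a y) {xs = E} f∈
      in c , (λ c∈U → c∉ (there (there c∈U))) ,
         ((λ a≡c → c∉ (here (sym a≡c))) , f , f∈E , a∈f , c∈f) ,
         heavy (λ c≡y → c∉ (there (here c≡y))) f∈E c∈f y∈f
      where
      many : 2 ^ (2 + length U) < length (common a y)
      many =
        ≤-<-trans (≤-trans (^-monoʳ-≤ 2 (+-monoʳ-≤ 2 U≤B)) (m≤m+n _ (size F))) (heavy a≢y e∈ a∈ y∈)

    dense-linked : ∀ {a y} → Side a y → Linked (suc l) s a y
    dense-linked {a} {y} side U U≤s = subst (λ k → PathAvoiding k a y U) (+-comm l 1)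
      (climb (λ _ → Side a) (λ _ → proj₁) base (λ _ → step) l side U (+-monoˡ-≤ l U≤s))

    dense-theta : ¬ ThetaIn l t
    dense-theta (ι , ι-injective , adjacent) = berge-copy F H ι ι-injective g g-injective
      (λ e → E⊆H (proj₁ (in-common e))) ι⊆g free
      where
      open Theta l t using (path)
      tail head : Edge F → V
      tail e = let i , j , _ = theta-edge l t e in ι (path i (inject₁ j))
      head e = let i , j , _ = theta-edge l t e in ι (path i (suc j))
      sdr =
        representatives _≟ˢ_ (size F) (λ e → common (tail e) (head e))
          (λ e → common-unique (tail e) (head e)) []
              (λ e → let i , j , _ = theta-edge l t e in
                ≤-trans (m≤n+m (size F) _) (<⇒≤ (adjacent i j)))
      g = proj₁ sdr
      g-injective : Injective _≡_ _≡_ g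
      g-injective = proj₁ (proj₂ sdr)
      in-common : ∀ e → g e ∈ E × tail e ∈ˢ g e × head e ∈ˢ g e
      in-common e = ∈-filter⁻ (both? (tail e) (head e)) {xs = E} (proj₁ (proj₂ (proj₂ sdr)) e)
      ι⊆g : ∀ e {u} → u ∈ˢ ends F e → ι u ∈ˢ g e
      ι⊆g e {u} u∈ = cases (x∈p∪q⁻ _ _ (subst (u ∈ˢ_) (proj₂ (proj₂ (theta-edge l t e))) u∈))
        where
        cases : u ∈ˢ ⁅ _ ⁆ ⊎ u ∈ˢ ⁅ _ ⁆ → ι u ∈ˢ g e
        cases (inj₁ u∈) =
          subst (λ w → ι w ∈ˢ g e) (sym (x∈⁅y⁆⇒x≡y _ u∈)) (proj₁ (proj₂ (in-common e)))
        cases (inj₂ u∈) =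
          subst (λ w → ι w ∈ˢ g e) (sym (x∈⁅y⁆⇒x≡y _ u∈)) (proj₂ (proj₂ (in-common e)))

    -- As `2 ≤ r`, a remaining hyperedge contains two vertices, and these are linked.
    dense-absurd : ∀ {e} → ¬ e ∈ E
    dense-absurd {e} e∈ =
      let u , v , u≢v , u∈ , v∈ = 2≤∣p∣⇒∃₂ e (≤-trans 2≤r (≤-reflexive (sym (All.lookup (Hypergraph.uniform H) (E⊆H e∈)))))
      in dense-theta (linked⇒theta t ≤-refl (dense-linked (u≢v , e , e∈ , u∈ , v∈)))

  Item : Set
  Item = (V × V) × Subset n

  record Transversal (T : List Item) : Set where
    field
      pairs-unique  : Unique (map proj₁ T)
      hedges-unique : Unique (map proj₂ T)
      contained     : ∀ {τ} → τ ∈ T → Contains (proj₁ τ) (proj₂ τ)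
      hedge∈H       : ∀ {τ} → τ ∈ T → proj₂ τ ∈ edges H

  -- A peeled pair labels one of the hyperedges removed with it. Hyperedges labelled later do not
  -- contain this pair, so they are different.
  peeled⇒transversal : ∀ {κs E} → E ⊆ edges H → Peeled κs E →
                       ∃[ T ] Transversal T × map proj₁ T ≡ κs × (∀ {τ} → τ ∈ T → proj₂ τ ∈ E)
  peeled⇒transversal E⊆H done = [] , record
    { pairs-unique = [] ; hedges-unique = [] ; contained = λ () ; hedge∈H = λ () } , refl , λ ()
  peeled⇒transversal {E = E} E⊆H p₀@(peel {κ = κ} _ κ∈ p) =
    let in-rest = λ {e} → ∈-filter⁻ (∁? (contains? κ)) {v = e} {xs = E}
        e , e∈ , κe = find κ∈
        T , tr , T≡κs , T∈ = peeled⇒transversal (E⊆H ∘ proj₁ ∘ in-rest) p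
    in ((κ , e) ∷ T) , record
         { pairs-unique  = subst (λ κs → Unique (κ ∷ κs)) (sym T≡κs) (peeled-unique p₀)
         ; hedges-unique = All.tabulate (λ f∈ e≡f → let τ , τ∈ , f≡ = ∈-map⁻ proj₂ f∈ in
                             proj₂ (in-rest (T∈ τ∈)) (subst (Contains κ) (trans e≡f f≡) κe))
                           ∷ Transversal.hedges-unique tr
         ; contained     = λ { (here refl) → κe ; (there τ∈) → Transversal.contained tr τ∈ }
         ; hedge∈H       = λ { (here refl) → E⊆H e∈ ; (there τ∈) → Transversal.hedge∈H tr τ∈ }
         } , cong (κ ∷_) T≡κs ,
         λ { (here refl) → e∈ ; (there τ∈) → proj₁ (in-rest (T∈ τ∈)) }

  -- A dense part is impossible, so all hyperedges are peeled off, at most `cap` for each pair.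
  transversal : ∃[ T ] Transversal T × size H ≤ cap * length T
  transversal = branch (peeling (edges H) (Hypergraph.simple H))
    where
    branch : (∃[ E ] E ≢ [] × E ⊆ edges H × Unique E × Dense E) ⊎ ∃[ κs ] Peeled κs (edges H) →
             ∃[ T ] Transversal T × size H ≤ cap * length T
    branch (inj₁ ([] , E≢[] , _)) = contradiction refl E≢[]
    branch (inj₁ (E@(_ ∷ _) , _ , E⊆ , E-unique , dense)) =
      contradiction (here refl) (dense-absurd E E⊆ E-unique dense)
    branch (inj₂ (κs , peeled)) =
      let T , tr , T≡κs , _ = peeled⇒transversal id peeled in
      T , tr , ≤-trans (peeled-length peeled)
        (≤-reflexive (cong (cap *_) (trans (cong length (sym T≡κs)) (length-map proj₁ T))))

  -- The graph of labelling pairs and the bound on its number of edges.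

  module _ {T : List Item} (tr : Transversal T) where

    open Transversal tr

    Joins : V → V → Item → Set
    Joins u v (κ , _) = κ ≡ (u , v) ⊎ κ ≡ (v , u)

    transversal-theta : ¬ Paths.ThetaIn (λ u v → ∃[ τ ] τ ∈ T × Joins u v τ) l t
    transversal-theta (ι , ι-injective , adjacent) =
      berge-copy F H ι ι-injective g g-injective (λ e → hedge∈H (item∈ e)) ι⊆g free
      where
      open Theta l t using (path)
      a b : Edge F → Fin (2 + t * l)
      a e = let i , j , _ = theta-edge l t e in path i (inject₁ j)
      b e = let i , j , _ = theta-edge l t e in path i (suc j)
      ends≡ : ∀ e → ends F e ≡ ⁅ a e ⁆ ∪ ⁅ b e ⁆
      ends≡ e = proj₂ (proj₂ (theta-edge l t e))
      choice : ∀ e → ∃[ τ ] τ ∈ T × Joins (ι (a e)) (ι (b e)) τ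
      choice e = let i , j , _ = theta-edge l t e in adjacent i j
      item : Edge F → Item
      item e = proj₁ (choice e)
      item∈ : ∀ e → item e ∈ T
      item∈ e = proj₁ (proj₂ (choice e))
      joins : ∀ e → Joins (ι (a e)) (ι (b e)) (item e)
      joins e = proj₂ (proj₂ (choice e))
      g : Edge F → Subset n
      g = proj₂ ∘ item
      same : ∀ {a b a′ b′ κ} → κ ≡ (ι a , ι b) → κ ≡ (ι a′ , ι b′) → ⁅ a ⁆ ∪ ⁅ b ⁆ ≡ ⁅ a′ ⁆ ∪ ⁅ b′ ⁆
      same refl eq =
        cong₂ (λ u v → ⁅ u ⁆ ∪ ⁅ v ⁆) (ι-injective (cong proj₁ eq)) (ι-injective (cong proj₂ eq))
      same-ends : ∀ {a b a′ b′ κ} → κ ≡ (ι a , ι b) ⊎ κ ≡ (ι b , ι a) →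
                  κ ≡ (ι a′ , ι b′) ⊎ κ ≡ (ι b′ , ι a′) → ⁅ a ⁆ ∪ ⁅ b ⁆ ≡ ⁅ a′ ⁆ ∪ ⁅ b′ ⁆
      same-ends (inj₁ p) (inj₁ q) = same p q
      same-ends (inj₁ p) (inj₂ q) = trans (same p q) (∪-comm ⁅ _ ⁆ ⁅ _ ⁆)
      same-ends (inj₂ p) (inj₁ q) = trans (∪-comm ⁅ _ ⁆ ⁅ _ ⁆) (same p q)
      same-ends (inj₂ p) (inj₂ q) = trans (∪-comm ⁅ _ ⁆ ⁅ _ ⁆) (trans (same p q) (∪-comm ⁅ _ ⁆ ⁅ _ ⁆))
      -- Equal hyperedges come from the same item, and the pair of an item determines the theta edge
      -- up to orientation.
      g-injective : Injective _≡_ _≡_ g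
      g-injective {e} {e′} eq = lookup-injective (Hypergraph.simple F)
        (trans (ends≡ e) (trans (same-ends (joins e)
          (subst (Joins (ι (a e′)) (ι (b e′)))
            (sym (map-injective hedges-unique (item∈ e) (item∈ e′) eq)) (joins e′)))
          (sym (ends≡ e′))))
      ι⊆g : ∀ e {u} → u ∈ˢ ends F e → ι u ∈ˢ g e
      ι⊆g e {u} u∈ = cases (x∈p∪q⁻ _ _ (subst (u ∈ˢ_) (ends≡ e) u∈)) (joins e) (contained (item∈ e))
        where
        cases : u ∈ˢ ⁅ a e ⁆ ⊎ u ∈ˢ ⁅ b e ⁆ → Joins (ι (a e)) (ι (b e)) (item e) →
                Contains (proj₁ (item e)) (g e) → ι u ∈ˢ g e
        cases (inj₁ u∈) (inj₁ κ≡) (_ , x∈ , y∈) =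
          subst (_∈ˢ g e) (trans (cong proj₁ κ≡) (cong ι (sym (x∈⁅y⁆⇒x≡y _ u∈)))) x∈
        cases (inj₁ u∈) (inj₂ κ≡) (_ , x∈ , y∈) =
          subst (_∈ˢ g e) (trans (cong proj₂ κ≡) (cong ι (sym (x∈⁅y⁆⇒x≡y _ u∈)))) y∈
        cases (inj₂ u∈) (inj₁ κ≡) (_ , x∈ , y∈) =
          subst (_∈ˢ g e) (trans (cong proj₂ κ≡) (cong ι (sym (x∈⁅y⁆⇒x≡y _ u∈)))) y∈
        cases (inj₂ u∈) (inj₂ κ≡) (_ , x∈ , y∈) =
          subst (_∈ˢ g e) (trans (cong proj₁ κ≡) (cong ι (sym (x∈⁅y⁆⇒x≡y _ u∈)))) x∈

    Incident : V → Item → Set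
    Incident y ((u , v) , _) = y ≡ u ⊎ y ≡ v

    incident? : ∀ y τ → Dec (Incident y τ)
    incident? y ((u , v) , _) = (y Fin.≟ u) ⊎-dec (y Fin.≟ v)

    module Degrees (D : ℕ) = Peeling (allFin n) ∈-allFin Incident incident? D

    other : V → Item → V
    other y ((u , v) , _) with y Fin.≟ u
    ... | yes _ = v
    ... | no  _ = u

    other-joins : ∀ {y} τ → Incident y τ → Joins y (other y τ) τ
    other-joins {y} ((u , v) , _) inc with y Fin.≟ u | inc
    ... | yes refl | _         = inj₁ refl
    ... | no  y≢u  | inj₁ y≡u  = contradiction y≡u y≢u
    ... | no  _    | inj₂ refl = inj₂ refl

    joins-incident : ∀ {y z} τ → Joins y z τ → Incident z τ
    joins-incident _ (inj₁ refl) = inj₂ refl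
    joins-incident _ (inj₂ refl) = inj₁ refl

    -- An item is determined by its pair, and two opposite orientations cannot both be increasing.
    joins-same : ∀ {y z} τ τ′ → τ ∈ T → τ′ ∈ T → Joins y z τ → Joins y z τ′ → τ ≡ τ′
    joins-same _ _ τ∈ τ′∈ (inj₁ κ≡) (inj₁ κ′≡) =
      map-injective pairs-unique τ∈ τ′∈ (trans κ≡ (sym κ′≡))
    joins-same _ _ τ∈ τ′∈ (inj₂ κ≡) (inj₂ κ′≡) =
      map-injective pairs-unique τ∈ τ′∈ (trans κ≡ (sym κ′≡))
    joins-same _ _ τ∈ τ′∈ (inj₁ refl) (inj₂ refl) =
      contradiction (proj₁ (contained τ∈)) (<⇒≯ (proj₁ (contained τ′∈)))
    joins-same _ _ τ∈ τ′∈ (inj₂ refl) (inj₁ refl) =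
      contradiction (proj₁ (contained τ∈)) (<⇒≯ (proj₁ (contained τ′∈)))

    module _ (D : ℕ) (T′ : List Item) (T′⊆T : T′ ⊆ T) (T′-unique : Unique T′)
             (dense : Degrees.Dense D T′) where

      around : V → List Item
      around y = filter (incident? y) T′

      in-around : ∀ {y τ} → τ ∈ around y → τ ∈ T′ × Incident y τ
      in-around {y} = ∈-filter⁻ (incident? y) {xs = T′}

      -- Truncation gives exactly `D` out-neighbours to every vertex that occurs in `T′`, but the
      -- relation may cease to be symmetric.
      N : V → List V
      N y = take D (map (other y) (around y))

      N-unique : ∀ y → Unique (N y)
      N-unique y =
        Unique.take⁺ D (unique-map (other y) inj (Unique.filter⁺ (incident? y) T′-unique))
        where
        inj : ∀ {τ τ′} → τ ∈ around y → τ′ ∈ around y → other y τ ≡ other y τ′ → τ ≡ τ′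
        inj {τ} {τ′} τ∈ τ′∈ eq =
          let τ∈T′ , i = in-around τ∈ ; τ′∈T′ , i′ = in-around τ′∈ in
          joins-same τ τ′ (T′⊆T τ∈T′) (T′⊆T τ′∈T′) (other-joins τ i)
            (subst (λ z → Joins y z τ′) (sym eq) (other-joins τ′ i′))

      length-N : ∀ y → length (N y) ≡ D ⊓ length (around y)
      length-N y = trans (length-take D _) (cong (D ⊓_) (length-map (other y) (around y)))

      N≤D : ∀ y → length (N y) ≤ D
      N≤D y = ≤-trans (≤-reflexive (length-N y)) (m⊓n≤m D _)

      N-joins : ∀ {y z} → z ∈ N y → ∃[ τ ] τ ∈ T′ × Joins y z τ
      N-joins {y} z∈ =
        let τ , τ∈ , z≡ = ∈-map⁻ (other y) (∈-take⁻ D z∈)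
            τ∈T′ , i = in-around τ∈
        in τ , τ∈T′ , subst (λ z → Joins y z τ) (sym z≡) (other-joins τ i)

      regular : ∀ {y τ} → τ ∈ T′ → Incident y τ → length (N y) ≡ D
      regular {y} τ∈ i = trans (length-N y) (m≤n⇒m⊓n≡m (<⇒≤ (dense y (lose τ∈ i))))

      module C = CountingPaths Fin._≟_ (allFin n) ∈-allFin (Unique.allFin⁺ n) N N-unique D N≤D l s

      dense-bound : ∀ {τ} → τ ∈ T′ → D ^ suc l ≤ n * Q ^ l + loss (suc l) * D ^ l
      dense-bound {τ} τ∈ =
        subst (λ m → D ^ suc l ≤ m * Q ^ l + loss (suc l) * D ^ l) (length-tabulate {n = n} id)
        (C.walk-bound unlinked (λ z∈ → let τ′ , τ′∈ , j = N-joins z∈ in regular τ′∈ (joins-incident τ′ j))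
                      (regular τ∈ (inj₁ refl)))
        where
        edge : ∀ {u v} → v ∈ N u ⊎ u ∈ N v → ∃[ τ ] τ ∈ T × Joins u v τ
        edge (inj₁ v∈) = let τ , τ∈ , j = N-joins v∈ in τ , T′⊆T τ∈ , j
        edge (inj₂ u∈) = let τ , τ∈ , j = N-joins u∈ in τ , T′⊆T τ∈ , swap j
        unlinked : ∀ a b → ¬ Paths.Linked (λ u v → v ∈ N u ⊎ u ∈ N v) (suc l) s a b
        unlinked a b linked =
          let ι , ι-injective , adjacent = Paths.linked⇒theta (λ u v → v ∈ N u ⊎ u ∈ N v) t ≤-refl linked in
          transversal-theta (ι , ι-injective , λ i j → edge (adjacent i j))

    -- Peeling off all vertices, each with at most `D` items, would account for at most `D * n`
    -- items, so a dense part must remain.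
    transversal-bound : ∀ D → D * n < length T → D ^ suc l ≤ n * Q ^ l + loss (suc l) * D ^ l
    transversal-bound D many = branch (Degrees.peeling D T (Unique.map⁻ pairs-unique))
      where
      branch : (∃[ T′ ] T′ ≢ [] × T′ ⊆ T × Unique T′ × Degrees.Dense D T′) ⊎ ∃[ κs ] Degrees.Peeled D κs T →
               D ^ suc l ≤ n * Q ^ l + loss (suc l) * D ^ l
      branch (inj₁ ([] , T′≢[] , _)) = contradiction refl T′≢[]
      branch (inj₁ (T′@(_ ∷ _) , _ , T′⊆ , T′-unique , dense)) =
        dense-bound D T′ T′⊆ T′-unique dense (here refl)
      branch (inj₂ (κs , peeled)) = contradiction (begin
        length T          ≤⟨ Degrees.peeled-length D peeled ⟩
        D * length κs
          ≤⟨ *-monoʳ-≤ D (≤-trans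
               (length-⊆ (Degrees.peeled-unique D peeled) (λ _ → ∈-allFin _))
               (≤-reflexive (length-tabulate {n = n} id))) ⟩
        D * n             ∎) (<⇒≱ many)
        where open ≤-Reasoning

-- Arithmetic of the constants, and the theorem.

^-distribʳ-* : ∀ k m n → (m * n) ^ k ≡ m ^ k * n ^ k
^-distribʳ-* zero    m n = refl
^-distribʳ-* (suc k) m n = trans (cong (m * n *_) (^-distribʳ-* k m n)) (lemma m n (m ^ k) (n ^ k))
  where
  lemma : ∀ m n a b → m * n * (a * b) ≡ m * a * (n * b)
  lemma = solve-∀

-- If `D ≤ 2 * L`, then `suc D` is at most the constant. Otherwise `L * D ^ l` is at most half of
-- `D ^ suc l`, which leaves `D ^ suc l ≤ 2 * q ^ l * n`, and `suc D ≤ 2 * D`.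
^-suc-bound : ∀ l q L D n .{{_ : NonZero q}} .{{_ : NonZero n}} →
              D ^ suc l ≤ n * q ^ l + L * D ^ l →
              suc D ^ suc l ≤ (2 * L + 1 + 2 * (2 * q)) ^ suc l * n
^-suc-bound l q L D n h = branch (D ≤? 2 * L)
  where
  open ≤-Reasoning
  k = suc l
  K = 2 * L + 1 + 2 * (2 * q)
  branch : Dec (D ≤ 2 * L) → suc D ^ k ≤ K ^ k * n
  branch (yes D≤2L) = begin
    suc D ^ k
      ≤⟨ ^-monoˡ-≤ k (≤-trans (s≤s D≤2L) (≤-trans (≤-reflexive (+-comm 1 (2 * L))) (m≤m+n (2 * L + 1) _))) ⟩
    K ^ k          ≤⟨ m≤m*n (K ^ k) n ⟩
    K ^ k * n      ∎
  branch (no D≰2L) = begin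
    suc D ^ k                   ≤⟨ ^-monoˡ-≤ k (+-monoʳ-≤ 1 (m≤m+n D 0)) ⟩
    (1 + (D + 0)) ^ k           ≤⟨ ^-monoˡ-≤ k (+-monoˡ-≤ (D + 0) (≤-trans (s≤s z≤n) (≰⇒> D≰2L))) ⟩
    (2 * D) ^ k                 ≡⟨ ^-distribʳ-* k 2 D ⟩
    2 ^ k * D ^ k               ≤⟨ *-monoʳ-≤ (2 ^ k) large ⟩
    2 ^ k * (2 * q ^ l * n)
      -- Both `2` and `q ^ l` are enlarged to `k`-th powers, so that all constants merge into one
      -- `k`-th power.
      ≤⟨ *-monoʳ-≤ (2 ^ k) (*-monoˡ-≤ n (*-mono-≤ (m≤m*n 2 (2 ^ l) {{m^n≢0 2 l}}) (m≤n*m (q ^ l) q))) ⟩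
    2 ^ k * (2 ^ k * q ^ k * n) ≡⟨ cong (2 ^ k *_) (cong (_* n) (sym (^-distribʳ-* k 2 q))) ⟩
    2 ^ k * ((2 * q) ^ k * n)   ≡⟨ *-assoc (2 ^ k) _ n ⟨
    2 ^ k * (2 * q) ^ k * n     ≡⟨ cong (_* n) (sym (^-distribʳ-* k 2 (2 * q))) ⟩
    (2 * (2 * q)) ^ k * n       ≤⟨ *-monoˡ-≤ n (^-monoˡ-≤ k (m≤n+m (2 * (2 * q)) (2 * L + 1))) ⟩
    K ^ k * n                   ∎
    where
    double : ∀ n q L d → 2 * (n * q + L * d) ≡ 2 * q * n + 2 * L * d
    double = solve-∀
    large : D ^ k ≤ 2 * q ^ l * n
    large = +-cancelʳ-≤ (D ^ k) (D ^ k) (2 * q ^ l * n) (begin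
      D ^ k + D ^ k                       ≡⟨ cong (D ^ k +_) (+-identityʳ (D ^ k)) ⟨
      2 * D ^ k                           ≤⟨ *-monoʳ-≤ 2 h ⟩
      2 * (n * q ^ l + L * D ^ l)         ≡⟨ double n (q ^ l) L (D ^ l) ⟩
      2 * q ^ l * n + 2 * L * D ^ l
        ≤⟨ +-monoʳ-≤ (2 * q ^ l * n) (*-monoˡ-≤ (D ^ l) (<⇒≤ (≰⇒> D≰2L))) ⟩
      2 * q ^ l * n + D ^ k               ∎)

-- The inequality is raised to the power `k`, which clears the exponent `1 + 1/k` and keeps it
-- within the natural numbers.
theorem2 : ∀ (r : ℕ) → 2 ≤ r →
    ∀ (k t : ℕ) .{{_ : NonZero k}} .{{_ : NonZero t}} →
    ∃[ c ] ∀ (n : ℕ) .{{_ : NonZero n}} →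
    ∀ (x : ℕ) → IsEx r n (Berge (Θ k t) r) x → x ^ k ≤ c ^ k * n ^ suc k
theorem2 r 2≤r (suc l) t = cap * K , λ { n _ ((H , free , refl) , _) → bound n H free }
  where
  open Constants l (t * l) using (Q; loss; 1≤Q)
  open ≤-Reasoning
  k cap K : ℕ
  k   = suc l
  cap = codegreeCap l t
  K   = 2 * loss k + 1 + 2 * (2 * Q)
  bound : ∀ n .{{_ : NonZero n}} (H : Hypergraph r n) → H IsFree-of Berge (Θ k t) r →
          size H ^ k ≤ (cap * K) ^ k * n ^ suc k
  bound n H free = cases transversal
    where
    open BergeTheta 2≤r l t H free using (Item; Transversal; transversal; transversal-bound)
    arrange : ∀ a b c d → a * (b * c * d) ≡ a * b * (c * d)
    arrange = solve-∀
    cases : ∃[ T ] Transversal T × size H ≤ cap * length T → size H ^ k ≤ (cap * K) ^ k * n ^ suc k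
    cases ([] , _ , H≤) = ≤-trans (^-monoˡ-≤ k (≤-trans H≤ (≤-reflexive (*-zeroʳ cap)))) z≤n
    cases (T@(_ ∷ T′) , tr , H≤) = begin
      size H ^ k                         ≤⟨ ^-monoˡ-≤ k (≤-trans H≤ (*-monoʳ-≤ cap T≤)) ⟩
      (cap * (suc D * n)) ^ k
        ≡⟨ trans (^-distribʳ-* k cap _) (cong (cap ^ k *_) (^-distribʳ-* k (suc D) n)) ⟩
      cap ^ k * (suc D ^ k * n ^ k)
        ≤⟨ *-monoʳ-≤ (cap ^ k) (*-monoˡ-≤ (n ^ k)
               (^-suc-bound l Q (loss k) D n {{>-nonZero 1≤Q}} (transversal-bound tr D D*n<T))) ⟩
      cap ^ k * (K ^ k * n * n ^ k)      ≡⟨ arrange (cap ^ k) (K ^ k) n (n ^ k) ⟩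
      cap ^ k * K ^ k * n ^ suc k        ≡⟨ cong (_* n ^ suc k) (sym (^-distribʳ-* k cap K)) ⟩
      (cap * K) ^ k * n ^ suc k          ∎
      where
      -- Dividing `length T - 1` rather than `length T` gives `D * n < length T ≤ suc D * n`, with
      -- the strict inequality on the side where `transversal-bound` requires it.
      D = length T′ / n
      division : length T′ ≡ length T′ % n + D * n
      division = m≡m%n+[m/n]*n (length T′) n
      D*n<T : D * n < length T
      D*n<T = s≤s (≤-trans (m≤n+m (D * n) (length T′ % n)) (≤-reflexive (sym division)))
      T≤ : length T ≤ suc D * n
      T≤ = ≤-trans (s≤s (≤-reflexive division)) (+-monoˡ-≤ (D * n) (m%n<n (length T′) n))
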